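{- For all sufficiently large real $x$, we have $$\#\mathcal{N}_{10}(x) < x^{0.717}$$ and $$x^{0.526} < \#\mathcal{N}_{10,0}(x) < x^{0.787}.$$
   Context: For a positive integer $n$, let $p_{10}(n)$ be the product of all the base $10$ digits of $n$ (in its usual representation without leading zeros), and let $p_{10,0}(n)$ be the product of the nonzero base $10$ digits of $n$. For real $x \geq 1$, define the sets of positive integers $$\mathcal{N}_{10}(x) := \{n \leq x : p_{10}(n) \mid n\}, \qquad \mathcal{N}_{10,0}(x) := \{n \leq x : p_{10,0}(n) \mid n\}.$$ (If $n$ has a zero digit then $p_{10}(n)=0$ does not divide $n$.) $\#S$ denotes the cardinality of the set $S$. -}

module Defs where

open import Data.Bool using (true; false; if_then_else_)
open import Data.Digit using (toNatDigits)
open import Data.Integer as ℤ using (-[1+_])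
import Data.Integer.Properties as ℤ
open import Data.List using (List; []; _∷_; _++_; length; filter)
open import Data.List.Membership.Propositional using (_∈_)
open import Data.List.Properties using (++-assoc; ++-identityʳ)
open import Data.List.Relation.Binary.BagAndSetEquality using (∼bag⇒↭)
open import Data.List.Relation.Binary.Permutation.Propositional.Properties using (↭-length)
import Data.List.Relation.Unary.All as All
import Data.List.Relation.Unary.AllPairs as AllPairs
open import Data.List.Relation.Unary.Any using (here; there)
open import Data.List.Membership.Propositional.Properties.WithK using (unique∧set⇒bag)
open import Data.List.Relation.Unary.Unique.Propositional using (Unique)
open import Data.Nat as ℕ using (ℕ; zero; suc; sz<ss)
open import Data.Nat.DivMod using (m/n<m; m<n⇒m/n≡0; m<n⇒m%n≡m; m≥n⇒m/n>0)
import Data.Nat.Divisibility as ℕ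
open import Data.Nat.Induction using (Acc; acc; <-wellFounded-fast)
open import Data.Nat.ListAction using (product)
import Data.Nat.Properties as ℕ
open import Data.Product using (∃; ∃-syntax; _×_; _,_; proj₁; proj₂)
open import Data.Rational as ℚ
  using (ℚ; mkℚ; 0ℚ; 1ℚ; _+_; _*_; _-_; -_; _<_; _⊓_; 1/_; _/_; toℚᵘ)
  renaming (_≤_ to _≤ℚ_)
open import Data.Rational.Properties as ℚ using (+-*-rawSemiring)
open import Algebra.Definitions.RawSemiring +-*-rawSemiring using (_^_)
open import Data.Rational.Solver using (module +-*-Solver)
import Data.Rational.Unnormalised as ℚᵘ
import Data.Rational.Unnormalised.Properties as ℚᵘ
open import Data.Sum using (_⊎_; inj₁; inj₂)
open import Function using (_∘_; _⇔_; mk⇔; case_of_; Equivalence)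
open import Induction.WellFounded using (acc-inverse)
open import Level using (0ℓ)
open import Relation.Binary.Definitions using (tri<; tri≈; tri>)
open import Relation.Binary.PropositionalEquality
open import Relation.Nullary using (¬_; Dec; does; yes; no; contradiction; ¬?)
open import Relation.Nullary.Decidable using (from-yes; dec-true; ¬¬-excluded-middle)
open import Relation.Unary using (Pred)

------------------------------------------------------------------------
-- Powers of rational numbers

0<1 : 0ℚ < 1ℚ
0<1 = from-yes (0ℚ ℚ.<? 1ℚ)

*-mono-≤ : ∀ {a b c d} → 0ℚ ≤ℚ c → 0ℚ ≤ℚ b → a ≤ℚ b → c ≤ℚ d → a * c ≤ℚ b * d
*-mono-≤ {a} {b} {c} {d} 0≤c 0≤b a≤b c≤d = ℚ.≤-trans
  (ℚ.*-monoʳ-≤-nonNeg c {{ℚ.nonNegative 0≤c}} a≤b)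
  (ℚ.*-monoˡ-≤-nonNeg b {{ℚ.nonNegative 0≤b}} c≤d)

*-nonNeg : ∀ {a b} → 0ℚ ≤ℚ a → 0ℚ ≤ℚ b → 0ℚ ≤ℚ a * b
*-nonNeg {a} {b} 0≤a 0≤b = subst (_≤ℚ a * b) (ℚ.*-zeroˡ b)
  (ℚ.*-monoʳ-≤-nonNeg b {{ℚ.nonNegative 0≤b}} 0≤a)

^-nonNeg : ∀ n {a} → 0ℚ ≤ℚ a → 0ℚ ≤ℚ a ^ n
^-nonNeg zero    0≤a = ℚ.<⇒≤ 0<1
^-nonNeg (suc n) 0≤a = *-nonNeg 0≤a (^-nonNeg n 0≤a)

^-mono-≤ : ∀ n {a b} → 0ℚ ≤ℚ a → a ≤ℚ b → a ^ n ≤ℚ b ^ n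
^-mono-≤ zero    0≤a a≤b = ℚ.≤-refl
^-mono-≤ (suc n) 0≤a a≤b =
  *-mono-≤ (^-nonNeg n 0≤a) (ℚ.≤-trans 0≤a a≤b) a≤b (^-mono-≤ n 0≤a a≤b)

^-cancel-< : ∀ n {a b} → 0ℚ ≤ℚ b → a ^ n < b ^ n → a < b
^-cancel-< n {a} {b} 0≤b aⁿ<bⁿ with a ℚ.<? b
... | yes a<b = a<b
... | no  a≮b = contradiction (ℚ.<-≤-trans aⁿ<bⁿ (^-mono-≤ n 0≤b (ℚ.≮⇒≥ a≮b))) (ℚ.<-irrefl refl)

1≤^ : ∀ n {a} → 1ℚ ≤ℚ a → 1ℚ ≤ℚ a ^ n
1≤^ zero    1≤a = ℚ.≤-refl
1≤^ (suc n) {a} 1≤a = subst (_≤ℚ a * a ^ n) (ℚ.*-identityˡ 1ℚ)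
  (*-mono-≤ (ℚ.<⇒≤ 0<1) (ℚ.≤-trans (ℚ.<⇒≤ 0<1) 1≤a) 1≤a (1≤^ n 1≤a))

a≤a^ : ∀ n .{{_ : ℕ.NonZero n}} {a} → 1ℚ ≤ℚ a → a ≤ℚ a ^ n
a≤a^ (suc n) {a} 1≤a = subst (_≤ℚ a * a ^ n) (ℚ.*-identityʳ a)
  (*-mono-≤ (ℚ.<⇒≤ 0<1) 0≤a ℚ.≤-refl (1≤^ n 1≤a))
  where 0≤a = ℚ.≤-trans (ℚ.<⇒≤ 0<1) 1≤a

^-mono-< : ∀ n .{{_ : ℕ.NonZero n}} {a b} → 0ℚ ≤ℚ a → a < b → a ^ n < b ^ n
^-mono-< (suc n) {a} {b} 0≤a a<b = ℚ.≤-<-trans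
  (ℚ.*-monoˡ-≤-nonNeg a {{ℚ.nonNegative 0≤a}} (^-mono-≤ n 0≤a (ℚ.<⇒≤ a<b)))
  (ℚ.*-monoˡ-<-pos (b ^ n) {{ℚ.positive (0<b^ n)}} a<b)
  where
  0<b = ℚ.≤-<-trans 0≤a a<b
  0<b^ : ∀ m → 0ℚ < b ^ m
  0<b^ zero    = 0<1
  0<b^ (suc m) = subst (_< b * b ^ m) (ℚ.*-zeroʳ b)
    (ℚ.*-monoʳ-<-pos b {{ℚ.positive 0<b}} (0<b^ m))

0^ : ∀ n .{{_ : ℕ.NonZero n}} → 0ℚ ^ n ≡ 0ℚ
0^ (suc n) = ℚ.*-zeroˡ (0ℚ ^ n)

fromℕℚ : ℕ → ℚ
fromℕℚ n = ℤ.+ n / 1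

fromℕℚ-suc : ∀ n → fromℕℚ (suc n) ≡ fromℕℚ n + 1ℚ
fromℕℚ-suc n = ℚ.toℚᵘ-injective (begin
  toℚᵘ (fromℕℚ (suc n))                  ≈⟨ ℚ.toℚᵘ-fromℚᵘ (ℚᵘ.mkℚᵘ (ℤ.+ suc n) 0) ⟩
  ℚᵘ.mkℚᵘ (ℤ.+ suc n) 0                    ≈⟨ ℚᵘ.*≡* (cong (ℤ._* ℤ.+ 1) n+1) ⟩
  ℚᵘ.mkℚᵘ (ℤ.+ n) 0 ℚᵘ.+ ℚᵘ.1ℚᵘ            ≈⟨ ℚᵘ.+-congˡ ℚᵘ.1ℚᵘ (ℚ.toℚᵘ-fromℚᵘ (ℚᵘ.mkℚᵘ (ℤ.+ n) 0)) ⟨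
  toℚᵘ (fromℕℚ n) ℚᵘ.+ toℚᵘ 1ℚ           ≈⟨ ℚ.toℚᵘ-homo-+ (fromℕℚ n) 1ℚ ⟨
  toℚᵘ (fromℕℚ n + 1ℚ)                   ∎)
  where
  open import Relation.Binary.Reasoning.Setoid ℚᵘ.≃-setoid
  n+1 : ℤ.+ suc n ≡ ℤ.+ n ℤ.* ℤ.+ 1 ℤ.+ ℤ.+ 1
  n+1 = sym (trans (cong (ℤ._+ ℤ.+ 1) (ℤ.*-identityʳ (ℤ.+ n))) (cong ℤ.+_ (ℕ.+-comm n 1)))

fromℕℚ-mono-≤ : ∀ {m n} → m ℕ.≤ n → fromℕℚ m ≤ℚ fromℕℚ n
fromℕℚ-mono-≤ m≤n = go (ℕ.≤⇒≤′ m≤n)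
  where
  go : ∀ {m n} → m ℕ.≤′ n → fromℕℚ m ≤ℚ fromℕℚ n
  go ℕ.≤′-refl       = ℚ.≤-refl
  go {n = suc n} (ℕ.≤′-step m≤n) = ℚ.≤-trans (go m≤n)
    (subst₂ _≤ℚ_ (ℚ.+-identityʳ (fromℕℚ n)) (sym (fromℕℚ-suc n))
      (ℚ.+-monoʳ-≤ (fromℕℚ n) (ℚ.<⇒≤ 0<1)))

archimedean : ∀ q → ∃ λ n → q < fromℕℚ n
archimedean q@(mkℚ z d-1 _) = N , ℚ.toℚᵘ-cancel-<
  (ℚᵘ.<-respʳ-≃ (ℚᵘ.≃-sym (ℚ.toℚᵘ-fromℚᵘ (ℚᵘ.mkℚᵘ (ℤ.+ N) 0)))
    (ℚᵘ.*<* (subst (ℤ._< ℤ.+ N ℤ.* ℤ.+ suc d-1) (sym (ℤ.*-identityʳ z)) z<N*d)))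
  where
  N = suc ℤ.∣ z ∣
  z≤∣z∣ : ∀ i → i ℤ.≤ ℤ.+ ℤ.∣ i ∣
  z≤∣z∣ (ℤ.+ n)    = ℤ.≤-refl
  z≤∣z∣ -[1+ n ] = ℤ.-≤+
  z<N*d : z ℤ.< ℤ.+ N ℤ.* ℤ.+ suc d-1
  z<N*d = ℤ.≤-<-trans (z≤∣z∣ z)
    (ℤ.<-≤-trans (ℤ.+<+ (ℕ.n<1+n _)) (ℤ.≤-trans (ℤ.+≤+ (ℕ.m≤m*n N (suc d-1))) (ℤ.≤-reflexive (ℤ.pos-* N (suc d-1)))))

module _ (M : ℚ) where
  lipschitz : ℕ → ℚ
  lipschitz zero    = 0ℚ
  lipschitz (suc n) = M * lipschitz n + M ^ n

  lipschitz-nonNeg : 0ℚ ≤ℚ M → ∀ n → 0ℚ ≤ℚ lipschitz n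
  lipschitz-nonNeg 0≤M zero    = ℚ.≤-refl
  lipschitz-nonNeg 0≤M (suc n) =
    ℚ.+-mono-≤ (*-nonNeg 0≤M (lipschitz-nonNeg 0≤M n)) (^-nonNeg n 0≤M)

  ^-lipschitz : ∀ n {t h} → 0ℚ ≤ℚ t → 0ℚ ≤ℚ h → t + h ≤ℚ M →
                (t + h) ^ n ≤ℚ t ^ n + h * lipschitz n
  ^-lipschitz zero {t} {h} 0≤t 0≤h t+h≤M = ℚ.≤-reflexive (sym
    (trans (cong (1ℚ +_) (ℚ.*-zeroʳ h)) (ℚ.+-identityʳ 1ℚ)))
  ^-lipschitz (suc n) {t} {h} 0≤t 0≤h t+h≤M = begin
    (t + h) * (t + h) ^ n
      ≡⟨ ℚ.*-distribʳ-+ ((t + h) ^ n) t h ⟩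
    t * (t + h) ^ n + h * (t + h) ^ n
      ≤⟨ ℚ.+-mono-≤
           (ℚ.*-monoˡ-≤-nonNeg t {{ℚ.nonNegative 0≤t}} (^-lipschitz n 0≤t 0≤h t+h≤M))
           (ℚ.*-monoˡ-≤-nonNeg h {{ℚ.nonNegative 0≤h}} (^-mono-≤ n 0≤t+h t+h≤M)) ⟩
    t * (t ^ n + h * L) + h * M ^ n
      ≡⟨ cong (_+ h * M ^ n) (ℚ.*-distribˡ-+ t (t ^ n) (h * L)) ⟩
    t * t ^ n + t * (h * L) + h * M ^ n
      ≤⟨ ℚ.+-monoˡ-≤ (h * M ^ n) (ℚ.+-monoʳ-≤ (t * t ^ n)
           (ℚ.*-monoʳ-≤-nonNeg (h * L) {{ℚ.nonNegative 0≤hL}} t≤M)) ⟩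
    t * t ^ n + M * (h * L) + h * M ^ n
      ≡⟨ solve 5 (λ x M h L y → x :+ M :* (h :* L) :+ h :* y := x :+ h :* (M :* L :+ y)) refl
           (t * t ^ n) M h L (M ^ n) ⟩
    t * t ^ n + h * (M * L + M ^ n) ∎
    where
    open ℚ.≤-Reasoning
    open +-*-Solver
    L = lipschitz n
    0≤t+h = ℚ.+-mono-≤ 0≤t 0≤h
    t≤t+h = subst (_≤ℚ t + h) (ℚ.+-identityʳ t) (ℚ.+-monoʳ-≤ t 0≤h)
    t≤M = ℚ.≤-trans t≤t+h t+h≤M
    0≤hL = *-nonNeg 0≤h (lipschitz-nonNeg (ℚ.≤-trans 0≤t t≤M) n)

small-step : ∀ {δ K} → 0ℚ < δ → 0ℚ ≤ℚ K → ∃ λ h → 0ℚ < h × h ≤ℚ 1ℚ × h * K < δ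
small-step {δ} {K} 0<δ 0≤K = h , 0<h , ℚ.p⊓q≤q ε 1ℚ , hK<δ
  where
  K′ = K + 1ℚ
  instance
    K′>0 : ℚ.Positive K′
    K′>0 = ℚ.positive (ℚ.+-mono-≤-< 0≤K 0<1)
    K′≢0 : ℚ.NonZero K′
    K′≢0 = ℚ.pos⇒nonZero K′
  ε = δ * 1/ K′
  h = ε ⊓ 1ℚ
  0<ε : 0ℚ < ε
  0<ε = subst (_< ε) (ℚ.*-zeroˡ (1/ K′))
    (ℚ.*-monoˡ-<-pos (1/ K′) {{ℚ.1/pos⇒pos K′}} 0<δ)
  0<h : 0ℚ < h
  0<h with ℚ.⊓-sel ε 1ℚ
  ... | inj₁ eq = subst (0ℚ <_) (sym eq) 0<ε
  ... | inj₂ eq = subst (0ℚ <_) (sym eq) 0<1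
  open ℚ.≤-Reasoning
  hK<δ : h * K < δ
  hK<δ = begin-strict
    h * K            ≡⟨ ℚ.+-identityʳ (h * K) ⟨
    h * K + 0ℚ       <⟨ ℚ.+-monoʳ-< (h * K) 0<h ⟩
    h * K + h        ≡⟨ cong (h * K +_) (ℚ.*-identityʳ h) ⟨
    h * K + h * 1ℚ   ≡⟨ ℚ.*-distribˡ-+ h K 1ℚ ⟨
    h * K′           ≤⟨ ℚ.*-monoʳ-≤-nonNeg K′ {{ℚ.pos⇒nonNeg K′}} (ℚ.p⊓q≤p ε 1ℚ) ⟩
    δ * 1/ K′ * K′   ≡⟨ ℚ.*-assoc δ (1/ K′) K′ ⟩
    δ * (1/ K′ * K′) ≡⟨ cong (δ *_) (ℚ.*-inverseˡ K′) ⟩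
    δ * 1ℚ           ≡⟨ ℚ.*-identityʳ δ ⟩
    δ                ∎

crossing : ∀ {P : ℕ → Set} → (∀ k → Dec (P k)) → ¬ P 0 → ∀ N → P N →
           ∃ λ k → ¬ P k × P (suc k)
crossing P? ¬P0 zero    PN = contradiction PN ¬P0
crossing P? ¬P0 (suc N) PN with P? N
... | yes p = crossing P? ¬P0 N p
... | no ¬p = N , ¬p , PN

-- The n-th powers of positive rationals are dense in the positive rationals.
^-dense′ : ∀ n .{{_ : ℕ.NonZero n}} {a b} → 0ℚ ≤ℚ a → a < b →
          ∃ λ t → 0ℚ < t × a < t ^ n × t ^ n < b
^-dense′ n {a} {b} 0≤a a<b = t + h , ℚ.+-mono-≤-< 0≤t 0<h , a<t+h , t+h<b
  where
  open ℚ.≤-Reasoning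
  0≤b = ℚ.≤-trans 0≤a (ℚ.<⇒≤ a<b)
  x<x+1 : ∀ x → x < x + 1ℚ
  x<x+1 x = subst (_< x + 1ℚ) (ℚ.+-identityʳ x) (ℚ.+-monoʳ-< x 0<1)
  1≤b+1 : 1ℚ ≤ℚ b + 1ℚ
  1≤b+1 = ℚ.+-monoˡ-≤ 1ℚ 0≤b
  M = b + 1ℚ + 1ℚ
  1≤M = ℚ.≤-trans 1≤b+1 (ℚ.<⇒≤ (x<x+1 (b + 1ℚ)))
  0≤M = ℚ.≤-trans (ℚ.<⇒≤ 0<1) 1≤M
  δ = b - a
  0<δ : 0ℚ < δ
  0<δ = subst (_< δ) (ℚ.+-inverseʳ a) (ℚ.+-monoˡ-< (- a) a<b)
  step = small-step 0<δ (lipschitz-nonNeg M 0≤M n)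
  h = proj₁ step
  0<h = proj₁ (proj₂ step)
  h≤1 = proj₁ (proj₂ (proj₂ step))
  hK<δ = proj₂ (proj₂ (proj₂ step))
  instance
    h>0 : ℚ.Positive h
    h>0 = ℚ.positive 0<h
    h≢0 : ℚ.NonZero h
    h≢0 = ℚ.pos⇒nonZero h
  grid : ℕ → ℚ
  grid k = fromℕℚ k * h
  grid-suc : ∀ k → grid (suc k) ≡ grid k + h
  grid-suc k = begin-equality
    fromℕℚ (suc k) * h       ≡⟨ cong (_* h) (fromℕℚ-suc k) ⟩
    (fromℕℚ k + 1ℚ) * h      ≡⟨ ℚ.*-distribʳ-+ h (fromℕℚ k) 1ℚ ⟩
    grid k + 1ℚ * h          ≡⟨ cong (grid k +_) (ℚ.*-identityˡ h) ⟩
    grid k + h               ∎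
  grid-nonNeg : ∀ k → 0ℚ ≤ℚ grid k
  grid-nonNeg zero    = ℚ.≤-reflexive (sym (ℚ.*-zeroˡ h))
  grid-nonNeg (suc k) = subst (0ℚ ≤ℚ_) (sym (grid-suc k))
    (ℚ.+-mono-≤ (grid-nonNeg k) (ℚ.<⇒≤ 0<h))
  large = archimedean (M * 1/ h)
  M<grid : M < grid (proj₁ large)
  M<grid = begin-strict
    M                     ≡⟨ ℚ.*-identityʳ M ⟨
    M * 1ℚ                ≡⟨ cong (M *_) (ℚ.*-inverseˡ h) ⟨
    M * (1/ h * h)        ≡⟨ ℚ.*-assoc M (1/ h) h ⟨
    M * 1/ h * h          <⟨ ℚ.*-monoˡ-<-pos h (proj₂ large) ⟩
    grid (proj₁ large)    ∎
  exceeds : a < grid (proj₁ large) ^ n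
  exceeds = begin-strict
    a                        <⟨ a<b ⟩
    b                        <⟨ x<x+1 b ⟩
    b + 1ℚ                   <⟨ x<x+1 (b + 1ℚ) ⟩
    M                        <⟨ M<grid ⟩
    grid (proj₁ large)       ≤⟨ a≤a^ n (ℚ.≤-trans 1≤M (ℚ.<⇒≤ M<grid)) ⟩
    grid (proj₁ large) ^ n   ∎
  not-at-0 : ¬ (a < grid 0 ^ n)
  not-at-0 a<0 = ℚ.<-irrefl refl (ℚ.≤-<-trans 0≤a
    (subst (a <_) (trans (cong (_^ n) (ℚ.*-zeroˡ h)) (0^ n)) a<0))
  cross = crossing (λ k → a ℚ.<? grid k ^ n) not-at-0 (proj₁ large) exceeds
  t = grid (proj₁ cross)
  0≤t = grid-nonNeg (proj₁ cross)
  tⁿ≤a : t ^ n ≤ℚ a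
  tⁿ≤a = ℚ.≮⇒≥ (proj₁ (proj₂ cross))
  a<t+h : a < (t + h) ^ n
  a<t+h = subst (λ u → a < u ^ n) (grid-suc (proj₁ cross)) (proj₂ (proj₂ cross))
  t≤b+1 : t ≤ℚ b + 1ℚ
  t≤b+1 = ℚ.≮⇒≥ λ b+1<t → ℚ.<-irrefl refl (begin-strict
    t        ≤⟨ a≤a^ n (ℚ.≤-trans 1≤b+1 (ℚ.<⇒≤ b+1<t)) ⟩
    t ^ n    ≤⟨ tⁿ≤a ⟩
    a        <⟨ a<b ⟩
    b        <⟨ x<x+1 b ⟩
    b + 1ℚ   <⟨ b+1<t ⟩
    t        ∎)
  t+h<b : (t + h) ^ n < b
  t+h<b = begin-strict
    (t + h) ^ n                   ≤⟨ ^-lipschitz M n 0≤t (ℚ.<⇒≤ 0<h) (ℚ.+-mono-≤ t≤b+1 h≤1) ⟩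
    t ^ n + h * lipschitz M n     <⟨ ℚ.+-mono-≤-< tⁿ≤a hK<δ ⟩
    a + (b - a)                   ≡⟨ ℚ.+-comm a (b - a) ⟩
    b - a + a                     ≡⟨ ℚ.+-assoc b (- a) a ⟩
    b + (- a + a)                 ≡⟨ cong (b +_) (ℚ.+-inverseˡ a) ⟩
    b + 0ℚ                        ≡⟨ ℚ.+-identityʳ b ⟩
    b                             ∎

abstract
  ^-dense : ∀ n .{{_ : ℕ.NonZero n}} {a b} → 0ℚ ≤ℚ a → a < b →
            ∃ λ t → 0ℚ < t × a < t ^ n × t ^ n < b
  ^-dense = ^-dense′

------------------------------------------------------------------------
-- Real numbers

-- Two-sided Dedekind cuts: L q means q < x, and U q means x < q.
record ℝ : Set₁ where
  field
    L U         : ℚ → Set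
    L-inhabited : ∃ L
    U-inhabited : ∃ U
    L-lower     : ∀ {q r} → q < r → L r → L q
    U-upper     : ∀ {q r} → q < r → U q → U r
    L-open      : ∀ {q} → L q → ∃[ r ] q < r × L r
    U-open      : ∀ {r} → U r → ∃[ q ] q < r × U q
    disjoint    : ∀ {q} → ¬ (L q × U q)
    located     : ∀ {q r} → q < r → L q ⊎ U r

  L<U : ∀ {q r} → L q → U r → q < r
  L<U {q} {r} Lq Ur with ℚ.<-cmp q r
  ... | tri< q<r _ _   = q<r
  ... | tri≈ _ refl _  = contradiction (Lq , Ur) disjoint
  ... | tri> _ _ r<q   = contradiction (L-lower r<q Lq , Ur) disjoint

open ℝ

infix 4 _<ℝ_ _≤ℝ_

_<ℝ_ _≤ℝ_ : ℝ → ℝ → Set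
x <ℝ y = ∃[ q ] U x q × L y q
x ≤ℝ y = ¬ (y <ℝ x)

fromℚ : ℚ → ℝ
fromℚ p = record
  { L           = _< p
  ; U           = p <_
  ; L-inhabited = p - 1ℚ , subst (p - 1ℚ <_) (ℚ.+-identityʳ p) (ℚ.+-monoʳ-< p (from-yes (- 1ℚ ℚ.<? 0ℚ)))
  ; U-inhabited = p + 1ℚ , subst (_< p + 1ℚ) (ℚ.+-identityʳ p) (ℚ.+-monoʳ-< p 0<1)
  ; L-lower     = ℚ.<-trans
  ; U-upper     = λ q<r p<q → ℚ.<-trans p<q q<r
  ; L-open      = λ q<p → ℚ.<-dense q<p
  ; U-open      = λ p<r → let q , p<q , q<r = ℚ.<-dense p<r in q , q<r , p<q
  ; disjoint    = λ (q<p , p<q) → ℚ.<-asym q<p p<q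
  ; located     = located′
  }
  where
  located′ : ∀ {q r} → q < r → q < p ⊎ p < r
  located′ {q} q<r with q ℚ.<? p
  ... | yes q<p = inj₁ q<p
  ... | no  q≮p = inj₂ (ℚ.≤-<-trans (ℚ.≮⇒≥ q≮p) q<r)

fromℕ : ℕ → ℝ
fromℕ n = fromℚ (fromℕℚ n)

-- The power x^(m/n) of a real x > 0: for rational r ≥ 0, r < x^(m/n) means
-- rⁿ < xᵐ, that is, rⁿ < sᵐ for some rational s with 0 < s < x; and dually for
-- the upper cut.
power : (x : ℝ) → fromℕ 0 <ℝ x → (m n : ℕ) .{{_ : ℕ.NonZero m}} .{{_ : ℕ.NonZero n}} → ℝ
power x (q₀ , 0<q₀ , Lq₀) m n = record
  { L           = L′
  ; U           = U′
  ; L-inhabited = - 1ℚ , inj₁ (from-yes (- 1ℚ ℚ.<? 0ℚ))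
  ; U-inhabited = U′-inhabited
  ; L-lower     = L′-lower
  ; U-upper     = λ q<r (0<q , s , Us , sᵐ<qⁿ) →
      ℚ.<-trans 0<q q<r , s , Us , ℚ.<-≤-trans sᵐ<qⁿ (^-mono-≤ n (ℚ.<⇒≤ 0<q) (ℚ.<⇒≤ q<r))
  ; L-open      = L′-open
  ; U-open      = λ (0<r , s , Us , sᵐ<rⁿ) →
      let t , 0<t , sᵐ<tⁿ , tⁿ<rⁿ = ^-dense n (^-nonNeg m (0≤U Us)) sᵐ<rⁿ
      in t , ^-cancel-< n (ℚ.<⇒≤ 0<r) tⁿ<rⁿ , 0<t , s , Us , sᵐ<tⁿ
  ; disjoint    = disjoint′
  ; located     = located′
  }
  where
  L′ U′ : ℚ → Set
  L′ r = r < 0ℚ ⊎ (∃[ s ] 0ℚ < s × L x s × r ^ n < s ^ m)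
  U′ r = 0ℚ < r × (∃[ s ] U x s × s ^ m < r ^ n)

  0≤U : ∀ {s} → U x s → 0ℚ ≤ℚ s
  0≤U Us = ℚ.<⇒≤ (ℚ.<-trans 0<q₀ (L<U x Lq₀ Us))

  U′-inhabited : ∃ U′
  U′-inhabited =
    let s , Us = U-inhabited x
        0≤sᵐ   = ^-nonNeg m (0≤U Us)
        r      = s ^ m + 1ℚ
        1≤r    = ℚ.+-monoˡ-≤ 1ℚ 0≤sᵐ
        sᵐ<r   = subst (_< r) (ℚ.+-identityʳ (s ^ m)) (ℚ.+-monoʳ-< (s ^ m) 0<1)
    in r , ℚ.<-≤-trans 0<1 1≤r , s , Us , ℚ.<-≤-trans sᵐ<r (a≤a^ n 1≤r)

  L′-lower : ∀ {q r} → q < r → L′ r → L′ q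
  L′-lower {q} q<r L′r with q ℚ.<? 0ℚ
  ... | yes q<0 = inj₁ q<0
  ... | no  q≮0 with L′r
  ...   | inj₁ r<0                   = inj₁ (ℚ.<-trans q<r r<0)
  ...   | inj₂ (s , 0<s , Ls , rⁿ<sᵐ) =
    inj₂ (s , 0<s , Ls , ℚ.≤-<-trans (^-mono-≤ n (ℚ.≮⇒≥ q≮0) (ℚ.<⇒≤ q<r)) rⁿ<sᵐ)

  positive-L′ : ∀ {r} → 0ℚ ≤ℚ r → (∃[ s ] 0ℚ < s × L x s × r ^ n < s ^ m) →
                ∃[ t ] r < t × L′ t
  positive-L′ 0≤r (s , 0<s , Ls , rⁿ<sᵐ) =
    let t , 0<t , rⁿ<tⁿ , tⁿ<sᵐ = ^-dense n (^-nonNeg n 0≤r) rⁿ<sᵐ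
    in t , ^-cancel-< n (ℚ.<⇒≤ 0<t) rⁿ<tⁿ , inj₂ (s , 0<s , Ls , tⁿ<sᵐ)

  L′-open : ∀ {r} → L′ r → ∃[ t ] r < t × L′ t
  L′-open {r} L′r with r ℚ.<? 0ℚ
  ... | yes r<0 = let t , r<t , t<0 = ℚ.<-dense r<0 in t , r<t , inj₁ t<0
  ... | no  r≮0 with L′r
  ...   | inj₁ r<0 = contradiction r<0 r≮0
  ...   | inj₂ Lr  = positive-L′ (ℚ.≮⇒≥ r≮0) Lr

  disjoint′ : ∀ {r} → ¬ (L′ r × U′ r)
  disjoint′ (inj₁ r<0 , 0<r , _) = ℚ.<-asym r<0 0<r
  disjoint′ (inj₂ (s , 0<s , Ls , rⁿ<sᵐ) , _ , t , Ut , tᵐ<rⁿ) =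
    ℚ.<-asym (L<U x Ls Ut) (^-cancel-< m (ℚ.<⇒≤ 0<s) (ℚ.<-trans tᵐ<rⁿ rⁿ<sᵐ))

  located′ : ∀ {q r} → q < r → L′ q ⊎ U′ r
  located′ {q} {r} q<r with q ℚ.<? 0ℚ
  ... | yes q<0 = inj₁ (inj₁ q<0)
  ... | no  q≮0 =
    let 0≤q = ℚ.≮⇒≥ q≮0
        0<r = ℚ.≤-<-trans 0≤q q<r
        a , 0<a , qⁿ<aᵐ , aᵐ<rⁿ = ^-dense m (^-nonNeg n 0≤q) (^-mono-< n 0≤q q<r)
        b , 0<b , aᵐ<bᵐ , bᵐ<rⁿ = ^-dense m (^-nonNeg m (ℚ.<⇒≤ 0<a)) aᵐ<rⁿ
    in case located x (^-cancel-< m (ℚ.<⇒≤ 0<b) aᵐ<bᵐ) of λ where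
      (inj₁ La) → inj₁ (inj₂ (a , 0<a , La , qⁿ<aᵐ))
      (inj₂ Ub) → inj₂ (0<r , b , Ub , bᵐ<rⁿ)

------------------------------------------------------------------------
-- Cardinality of a set of natural numbers

Enumerates : List ℕ → Pred ℕ 0ℓ → Set
Enumerates ns S = Unique ns × (∀ n → n ∈ ns ⇔ S n)

#_≡_ : Pred ℕ 0ℓ → ℕ → Set
# S ≡ k = ∃[ ns ] Enumerates ns S × length ns ≡ k

#-unique : ∀ {S k l} → # S ≡ k → # S ≡ l → k ≡ l
#-unique (ms , (ms! , ∈ms⇔S) , refl) (ns , (ns! , ∈ns⇔S) , refl) =
  ↭-length (∼bag⇒↭ (unique∧set⇒bag ms! ns! λ {n} →
    mk⇔ (from (∈ns⇔S n) ∘ to (∈ms⇔S n)) (from (∈ms⇔S n) ∘ to (∈ns⇔S n))))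
  where open Equivalence

-- Membership of a natural number in {n | n ≤ x} is not decidable for a general
-- Dedekind real x, so a cardinality exists only up to double negation.
#-exists : ∀ {S} N → (∀ {n} → S n → n ℕ.< N) → ¬ ¬ (∃[ k ] # S ≡ k)
#-exists {S} N bounded ¬∃ = below N λ (ns , ns! , ∈ns⇔) → ¬∃
  (length ns , ns , (ns! , λ n → mk⇔ (proj₂ ∘ to (∈ns⇔ n)) (λ s → from (∈ns⇔ n) (bounded s , s))) , refl)
  where
  open Equivalence
  below : ∀ N → ¬ ¬ (∃[ ns ] Enumerates ns (λ n → n ℕ.< N × S n))
  below zero    ¬∃ = ¬∃ ([] , AllPairs.[] , λ n → mk⇔ (λ ()) (λ ()))
  below (suc N) ¬∃ = below N λ (ns , ns! , ∈ns⇔) → ¬¬-excluded-middle λ where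
    (yes s) → ¬∃
      ( N ∷ ns
      , All.tabulate (λ {n} n∈ns N≡n → ℕ.<-irrefl (sym N≡n) (proj₁ (to (∈ns⇔ n) n∈ns))) AllPairs.∷ ns!
      , λ n → mk⇔
          (λ where (here refl)  → ℕ.n<1+n N , s
                   (there n∈ns) → let n<N , sn = to (∈ns⇔ n) n∈ns in ℕ.m<n⇒m<1+n n<N , sn)
          (λ (n<1+N , sn) → case ℕ.m<1+n⇒m<n∨m≡n n<1+N of λ where
            (inj₁ n<N)  → there (from (∈ns⇔ n) (n<N , sn))
            (inj₂ refl) → here refl))
    (no ¬s) → ¬∃
      ( ns
      , ns!
      , λ n → mk⇔
          (λ n∈ns → let n<N , sn = to (∈ns⇔ n) n∈ns in ℕ.m<n⇒m<1+n n<N , sn)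
          (λ (n<1+N , sn) → case ℕ.m<1+n⇒m<n∨m≡n n<1+N of λ where
            (inj₁ n<N)  → from (∈ns⇔ n) (n<N , sn)
            (inj₂ refl) → contradiction sn ¬s))

------------------------------------------------------------------------
-- Decimal digits

-- The auxiliary function behind toNatDigits is local to it and so cannot be
-- named. It is recovered here by unification, in order to prove the recurrences
--   toNatDigits 10 n ≡ n ∷ []                                 for n < 10,
--   toNatDigits 10 n ≡ toNatDigits 10 (n / 10) ++ n % 10 ∷ []  for n ≥ 10.
module DecimalDigits where
  shrinks : ∀ n → suc n ℕ./ 10 ℕ.< suc n
  shrinks n = m/n<m (suc n) 10 sz<ss

  digits : ∀ n → Acc ℕ._<_ n → List ℕ
  digits zero      _        = 0 ∷ []
  digits n@(suc m) (acc wf) =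
    if does (0 ℕ.<? n ℕ./ 10) then digits (n ℕ./ 10) (wf (shrinks m)) ++ n ℕ.% 10 ∷ [] else n ℕ.% 10 ∷ []

  Aux : Set
  Aux = ∀ {n} → Acc ℕ._<_ n → List ℕ → List ℕ

  data Value (f : Aux) : List ℕ → Set where
    value : ∀ {m} (a : Acc ℕ._<_ m) xs → Value f (f a xs)

  mutual
    aux : ℕ → Aux
    aux = _

    aux-value : ∀ n → does (0 ℕ.<? suc n ℕ./ 10) ≡ true → Value (aux n) (toNatDigits 10 (suc n))
    aux-value n eq with does (0 ℕ.<? suc n ℕ./ 10) | eq
    ... | true | _ with suc n ℕ./ 10 | acc-inverse (<-wellFounded-fast (suc n)) (shrinks n) | suc n ℕ.% 10 ∷ []
    ...   | _ | a | xs = value a xs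

  aux-step : ∀ n m (wf : ∀ {k} → k ℕ.< suc m → Acc ℕ._<_ k) xs → aux n (acc wf) xs ≡
    (if does (0 ℕ.<? suc m ℕ./ 10) then aux n (wf (shrinks m)) (suc m ℕ.% 10 ∷ xs) else suc m ℕ.% 10 ∷ xs)
  aux-step n m wf xs with does (0 ℕ.<? suc m ℕ./ 10)
  ... | true  = refl
  ... | false = refl

  aux≡digits : ∀ n m (a b : Acc ℕ._<_ m) xs → aux n a xs ≡ digits m b ++ xs
  aux≡digits n zero    a        b         xs = refl
  aux≡digits n (suc m) (acc wf) (acc wf′) xs with does (0 ℕ.<? suc m ℕ./ 10) | aux-step n m wf xs
  ... | false | step = step
  ... | true  | step = trans step (trans
    (aux≡digits n (suc m ℕ./ 10) (wf (shrinks m)) (wf′ (shrinks m)) (suc m ℕ.% 10 ∷ xs))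
    (sym (++-assoc (digits (suc m ℕ./ 10) (wf′ (shrinks m))) (suc m ℕ.% 10 ∷ []) xs)))

  toNatDigits≡digits : ∀ n (a : Acc ℕ._<_ n) → toNatDigits 10 n ≡ digits n a
  toNatDigits≡digits zero    a = refl
  toNatDigits≡digits (suc n) a =
    trans (aux≡digits n (suc n) (<-wellFounded-fast (suc n)) a []) (++-identityʳ _)

  toNatDigits-< : ∀ {n} → n ℕ.< 10 → toNatDigits 10 n ≡ n ∷ []
  toNatDigits-< {zero}  _    = refl
  toNatDigits-< {suc n} n<10 = trans (toNatDigits≡digits (suc n) (acc wf))
    (trans
      (cong (λ q → if does (0 ℕ.<? q) then digits (suc n ℕ./ 10) (wf (shrinks n)) ++ suc n ℕ.% 10 ∷ [] else suc n ℕ.% 10 ∷ [])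
        (m<n⇒m/n≡0 n<10))
      (cong (_∷ []) (m<n⇒m%n≡m n<10)))
    where
    wf : ∀ {k} → k ℕ.< suc n → Acc ℕ._<_ k
    wf {k} _ = <-wellFounded-fast k

  toNatDigits-≥ : ∀ {n} → 10 ℕ.≤ n → toNatDigits 10 n ≡ toNatDigits 10 (n ℕ./ 10) ++ n ℕ.% 10 ∷ []
  toNatDigits-≥ {suc n} 10≤n = trans (toNatDigits≡digits (suc n) (acc wf))
    (trans
      (cong (if_then digits (suc n ℕ./ 10) (wf (shrinks n)) ++ suc n ℕ.% 10 ∷ [] else suc n ℕ.% 10 ∷ [])
        (dec-true (0 ℕ.<? suc n ℕ./ 10) (m≥n⇒m/n>0 10≤n)))
      (cong (_++ suc n ℕ.% 10 ∷ []) (sym (toNatDigits≡digits (suc n ℕ./ 10) (wf (shrinks n))))))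
    where
    wf : ∀ {k} → k ℕ.< suc n → Acc ℕ._<_ k
    wf {k} _ = <-wellFounded-fast k

open DecimalDigits public using (toNatDigits-<; toNatDigits-≥)

------------------------------------------------------------------------
-- Numbers divisible by the product of their digits

p₁₀ p₁₀,₀ : ℕ → ℕ
p₁₀   n = product (toNatDigits 10 n)
p₁₀,₀ n = product (filter (λ d → ¬? (d ℕ.≟ 0)) (toNatDigits 10 n))

𝒩₁₀ 𝒩₁₀,₀ : ℝ → Pred ℕ 0ℓ
𝒩₁₀   x n = 0 ℕ.< n × fromℕ n ≤ℝ x × p₁₀   n ℕ.∣ n
𝒩₁₀,₀ x n = 0 ℕ.< n × fromℕ n ≤ℝ x × p₁₀,₀ n ℕ.∣ n

≤ℝ-bounded : ∀ x → ∃[ N ] (∀ {n} → fromℕ n ≤ℝ x → n ℕ.< N)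
≤ℝ-bounded x =
  let u , Uu = U-inhabited x
      N , u<N = archimedean u
  in N , λ n≤x → ℕ.≰⇒> λ N≤n → n≤x (u , Uu , ℚ.<-≤-trans u<N (fromℕℚ-mono-≤ N≤n))

#𝒩₁₀-exists : ∀ x → ¬ ¬ (∃[ k ] # 𝒩₁₀ x ≡ k)
#𝒩₁₀-exists x = let N , bound = ≤ℝ-bounded x in #-exists N (λ (_ , n≤x , _) → bound n≤x)

#𝒩₁₀,₀-exists : ∀ x → ¬ ¬ (∃[ k ] # 𝒩₁₀,₀ x ≡ k)
#𝒩₁₀,₀-exists x = let N , bound = ≤ℝ-bounded x in #-exists N (λ (_ , n≤x , _) → bound n≤x)

{-# OPTIONS --safe #-}
module Submission where

-- Upper bounds. Sort the admissible n with j digits by the value D of their digit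
-- product; D is a product of powers of 2, 3, 5, 7, so there are only polynomially
-- many classes. A class has at most 10^j / D members, since these are multiples of
-- D, and at most D^s (Σ d^(-s))^j members by Rankin's trick, the sum running over
-- the allowed digits. The product of the s-th power of the first bound with the
-- second is free of D. The best choices are s close to 13/10 when zeros are ignored
-- and to 7/5 when they are forbidden.
--
-- Lower bound. A word w in the digits 0, 1, 2, 4, 5, 8 whose digit product has at
-- most K factors 2 and at most K factors 5 yields the admissible number 1 w 0…0
-- with K final zeros. Such words may be concatenated, so one word length with
-- sufficiently many words gives the bound for all x.

open import Defs
open import Data.Nat using (ℕ; zero; suc; _+_; _*_; _∸_; _^_; _≤_; _<_; _/_; _%_; NonZero; >-nonZero; >-nonZero⁻¹; ≢-nonZero; z≤n; s≤s)
open import Data.Product using (∃; ∃-syntax; _×_; _,_; proj₁; proj₂)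
open import Data.Digit using (toNatDigits)
open import Data.List using (List; []; _∷_; _++_; length; map; filter; concatMap; cartesianProductWith; cartesianProduct; upTo; replicate; foldl; take)
import Data.List.Properties as List
open import Data.List.Membership.Propositional using (_∈_; _∉_; find)
open import Data.List.Membership.Propositional.Properties
import Data.List.Relation.Binary.Permutation.Propositional.Properties as ↭
open import Data.List.Relation.Unary.All as All using (All; []; _∷_)
import Data.List.Relation.Unary.All.Properties as All
open import Data.List.Relation.Unary.AllPairs using ([]; _∷_)
open import Data.List.Relation.Unary.Any as Any using (here; there)
open import Data.List.Relation.Unary.Unique.Propositional using (Unique)
import Data.List.Relation.Unary.Unique.Propositional.Properties as Unique
open import Data.Nat.Combinatorics using (_C_; nCn≡1; nCk+nC[k+1]≡[n+1]C[k+1])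
open import Data.Nat.Divisibility using (_∣_; divides; ∣-trans; m∣m*n)
import Data.Nat.Divisibility as ℕ
import Data.Nat.DivMod as ℕ
open import Data.Nat.Induction using (<-rec)
open import Data.Nat.ListAction using (sum; product)
open import Data.Nat.ListAction.Properties using (sum-++; sum-↭; product-++; ∈⇒∣product)
import Data.Nat.Properties as ℕ
open import Data.Nat.Solver using (module +-*-Solver)
open import Data.Rational as ℚ using (0ℚ; 1ℚ)
import Data.Rational.Properties as ℚ
open import Data.Sum using (inj₁; inj₂)
open import Data.Empty using (⊥)
open import Function using (_∘_; Equivalence)
open import Relation.Binary.Definitions using (DecidableEquality)
open import Relation.Binary.PropositionalEquality
open import Relation.Nullary using (¬_; yes; no; contradiction; ¬?)
open import Relation.Nullary.Decidable using (True; toWitness)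
open import Data.Product.Properties using (≡-dec)
open import Algebra.Properties.CommutativeSemigroup ℕ.*-commutativeSemigroup using (x∙yz≈y∙xz)
open import Algebra.Definitions.RawSemiring ℚ.+-*-rawSemiring using () renaming (_^_ to _^ℚ_)

-- Lists without repetition

private variable
  A B : Set

sum-map-++ : ∀ (f : A → ℕ) xs ys → sum (map f (xs ++ ys)) ≡ sum (map f xs) + sum (map f ys)
sum-map-++ f xs ys = trans (cong sum (List.map-++ f xs ys)) (sum-++ (map f xs) (map f ys))

-- The occurrence of `x` in `ys` is moved to the front and split off. Since `x` does not recur in
-- `xs`, the rest of `xs` lies in what remains.
Unique-⊆⇒sum≤ : ∀ (f : A → ℕ) {xs ys} → Unique xs → (∀ {x} → x ∈ xs → x ∈ ys) →
                sum (map f xs) ≤ sum (map f ys)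
Unique-⊆⇒sum≤ f {[]}     _            _     = z≤n
Unique-⊆⇒sum≤ f {x ∷ xs} (x∉xs ∷ xs!) xs⊆ys with ps , qs , refl ← ∈-∃++ (xs⊆ys (here refl)) = begin
  f x + sum (map f xs)           ≤⟨ ℕ.+-monoʳ-≤ (f x) (Unique-⊆⇒sum≤ f xs! rest) ⟩
  f x + sum (map f (ps ++ qs))   ≡⟨ sum-↭ (↭.map⁺ f (↭.shift x ps qs)) ⟨
  sum (map f (ps ++ x ∷ qs))     ∎
  where
  open ℕ.≤-Reasoning
  rest : ∀ {y} → y ∈ xs → y ∈ ps ++ qs
  rest y∈xs with ↭.∈-resp-↭ (↭.shift x ps qs) (xs⊆ys (there y∈xs))
  ... | here y≡x = contradiction (sym y≡x) (All.lookup x∉xs y∈xs)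
  ... | there y∈ = y∈

sum-map-1 : ∀ (xs : List A) → sum (map (λ _ → 1) xs) ≡ length xs
sum-map-1 []       = refl
sum-map-1 (x ∷ xs) = cong suc (sum-map-1 xs)

Unique-⊆⇒length≤ : {xs ys : List A} → Unique xs → (∀ {x} → x ∈ xs → x ∈ ys) →
                   length xs ≤ length ys
Unique-⊆⇒length≤ {xs = xs} {ys} xs! xs⊆ys =
  subst₂ _≤_ (sum-map-1 xs) (sum-map-1 ys) (Unique-⊆⇒sum≤ (λ _ → 1) xs! xs⊆ys)

sum≤length*max : ∀ (f : A → ℕ) {y ys} → y ∈ ys →
                 ∃ λ x → x ∈ ys × sum (map f ys) ≤ length ys * f x
sum≤length*max f {ys = y ∷ []}     _ = y , here refl , ℕ.≤-refl
sum≤length*max f {ys = y ∷ z ∷ zs} _ with sum≤length*max f {z} {z ∷ zs} (here refl)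
... | x , x∈ , h with ℕ.≤-total (f y) (f x)
...   | inj₁ fy≤fx = x , there x∈ , ℕ.+-mono-≤ fy≤fx h
...   | inj₂ fx≤fy = y , here refl ,
  ℕ.+-monoʳ-≤ (f y) (ℕ.≤-trans h (ℕ.*-monoʳ-≤ (length (z ∷ zs)) fx≤fy))

length*min≤sum : ∀ (f : A → ℕ) {y ys} → y ∈ ys →
                 ∃ λ x → x ∈ ys × length ys * f x ≤ sum (map f ys)
length*min≤sum f {ys = y ∷ []}     _ = y , here refl , ℕ.≤-refl
length*min≤sum f {ys = y ∷ z ∷ zs} _ with length*min≤sum f {z} {z ∷ zs} (here refl)
... | x , x∈ , h with ℕ.≤-total (f y) (f x)
...   | inj₂ fx≤fy = x , there x∈ , ℕ.+-mono-≤ fx≤fy h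
...   | inj₁ fy≤fx = y , here refl ,
  ℕ.+-monoʳ-≤ (f y) (ℕ.≤-trans (ℕ.*-monoʳ-≤ (length (z ∷ zs)) fy≤fx) h)

length-concatMap : ∀ (f : A → List B) xs → length (concatMap f xs) ≡ sum (map (length ∘ f) xs)
length-concatMap f []       = refl
length-concatMap f (x ∷ xs) =
  trans (List.length-++ (f x)) (cong (length (f x) +_) (length-concatMap f xs))

-- The fibres of `f` over `ys` cover `xs`, and the largest of them has at least the average size.
pigeonhole : ∀ (_≟_ : DecidableEquality B) (f : A → B) {y ys xs} → y ∈ ys → Unique xs →
             (∀ {x} → x ∈ xs → f x ∈ ys) →
             ∃ λ z → z ∈ ys × length xs ≤ length ys * length (filter (λ x → f x ≟ z) xs)
pigeonhole _≟_ f {ys = ys} {xs} y∈ xs! f∈ =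
  let z , z∈ , h = sum≤length*max (length ∘ class) y∈ in z , z∈ , (begin
    length xs                          ≤⟨ Unique-⊆⇒length≤ xs! covered ⟩
    length (concatMap class ys)        ≡⟨ length-concatMap class ys ⟩
    sum (map (length ∘ class) ys)      ≤⟨ h ⟩
    length ys * length (class z)       ∎)
  where
  open ℕ.≤-Reasoning
  class = λ z → filter (λ x → f x ≟ z) xs
  covered : ∀ {x} → x ∈ xs → x ∈ concatMap class ys
  covered x∈ = ∈-concatMap⁺ class (Any.map (λ fx≡ → ∈-filter⁺ _ x∈ fx≡) (f∈ x∈))

-- `g` reads off from an entry the index of the block containing it, so distinct blocks are
-- disjoint.
Unique-concatMap : ∀ (f : A → List B) (g : B → A) {xs} → Unique xs →
                   All (λ x → Unique (f x) × All (λ y → g y ≡ x) (f x)) xs → Unique (concatMap f xs)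
Unique-concatMap f g {[]}     []           []                   = []
Unique-concatMap f g {x ∷ xs} (x∉xs ∷ xs!) ((fx! , g-fx) ∷ fxs) =
  Unique.++⁺ fx! (Unique-concatMap f g xs! fxs) disj
  where
  disj : ∀ {y} → y ∈ f x × y ∈ concatMap f xs → ⊥
  disj (y∈ , y∈′) with z , z∈ , y∈fz ← find (∈-concatMap⁻ f {xs = xs} y∈′) =
    All.lookup x∉xs z∈ (trans (sym (All.lookup g-fx y∈)) (All.lookup (proj₂ (All.lookup fxs z∈)) y∈fz))

length-cartesianProductWith : ∀ {C : Set} (f : A → B → C) xs ys →
                              length (cartesianProductWith f xs ys) ≡ length xs * length ys
length-cartesianProductWith f []       ys = refl
length-cartesianProductWith f (x ∷ xs) ys = trans (List.length-++ (map (f x) ys))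
  (cong₂ _+_ (List.length-map (f x) ys) (length-cartesianProductWith f xs ys))

-- Powers of natural numbers

^-distribʳ-* : ∀ m n k → (m * n) ^ k ≡ m ^ k * n ^ k
^-distribʳ-* m n zero    = refl
^-distribʳ-* m n (suc k) = trans (cong (m * n *_) (^-distribʳ-* m n k))
  (solve 4 (λ m n x y → m :* n :* (x :* y) := m :* x :* (n :* y)) refl m n (m ^ k) (n ^ k))
  where open +-*-Solver

^-swap : ∀ m n k → (m ^ n) ^ k ≡ (m ^ k) ^ n
^-swap m n k = trans (ℕ.^-*-assoc m n k) (trans (cong (m ^_) (ℕ.*-comm n k)) (sym (ℕ.^-*-assoc m k n)))

n<m^n : ∀ {m} → 1 < m → ∀ n → n < m ^ n
n<m^n         1<m zero    = s≤s z≤n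
n<m^n {m} 1<m (suc n) = begin-strict
  suc n        ≤⟨ n<m^n 1<m n ⟩
  m ^ n        <⟨ ℕ.^-monoʳ-< m 1<m (ℕ.n<1+n n) ⟩
  m ^ suc n    ∎
  where open ℕ.≤-Reasoning

-- Bernoulli's inequality cleared of denominators: for positive `B`, the ratio `A / B` is at least
-- `1 + 1 / B`, so its `q`-th power is at least `q / B`.
bernoulli : ∀ {B A} → B < A → ∀ q → q * B ^ q ≤ B * A ^ q
bernoulli         B<A zero    = z≤n
bernoulli {B} {A} B<A (suc q) = begin
  suc q * (B * B ^ q)          ≡⟨ solve 3 (λ q B x → (con 1 :+ q) :* (B :* x) := B :* (x :+ q :* x)) refl q B (B ^ q) ⟩
  B * (B ^ q + q * B ^ q)      ≤⟨ ℕ.*-monoʳ-≤ B (ℕ.+-mono-≤ (ℕ.^-monoˡ-≤ q (ℕ.<⇒≤ B<A)) (bernoulli B<A q)) ⟩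
  B * (suc B * A ^ q)          ≤⟨ ℕ.*-monoʳ-≤ B (ℕ.*-monoˡ-≤ (A ^ q) B<A) ⟩
  B * (A * A ^ q)              ∎
  where
  open ℕ.≤-Reasoning
  open +-*-Solver

-- With E = e + 1 and N = r + q E, the E-th power of Bernoulli's inequality
-- beats the polynomial factor by a factor of order q.
polynomial<exponential : ∀ c e {B A} → B < A →
  ∃ λ N₀ → ∀ {N} → N₀ ≤ N → c * (1 + 3 * N) ^ e * B ^ N < A ^ N
polynomial<exponential c e {B} {A} B<A = E * suc K , bound
  where
  open ℕ.≤-Reasoning
  open +-*-Solver
  E = suc e
  K = c * (6 * E) ^ e * B ^ E
  instance
    A≢0 : NonZero A
    A≢0 = >-nonZero (ℕ.≤-<-trans z≤n B<A)
  bound : ∀ {N} → E * suc K ≤ N → c * (1 + 3 * N) ^ e * B ^ N < A ^ N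
  -- Multiplying by `q` turns `q ^ e` into `q ^ E`, which combines with `(B ^ q) ^ E` into the power
  -- that `bernoulli` estimates.
  bound {N} N≥ = ℕ.*-cancelˡ-< q _ _ (begin-strict
    q * (c * (1 + 3 * N) ^ e * B ^ N)
      ≤⟨ ℕ.*-monoʳ-≤ q (ℕ.*-monoˡ-≤ (B ^ N) (ℕ.*-monoʳ-≤ c (ℕ.^-monoˡ-≤ e linear))) ⟩
    q * (c * (6 * E * q) ^ e * B ^ N)
      ≡⟨ cong₂ (λ x y → q * (c * x * y)) (^-distribʳ-* (6 * E) q e) (split B) ⟩
    q * (c * ((6 * E) ^ e * q ^ e) * (B ^ r * (B ^ q) ^ E))
      ≡⟨ solve 6 (λ q c x y z w → q :* (c :* (x :* y) :* (z :* w)) := c :* x :* (z :* (q :* y :* w)))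
           refl q c ((6 * E) ^ e) (q ^ e) (B ^ r) ((B ^ q) ^ E) ⟩
    c * (6 * E) ^ e * (B ^ r * (q ^ E * (B ^ q) ^ E))
      ≡⟨ cong (λ x → c * (6 * E) ^ e * (B ^ r * x)) (^-distribʳ-* q (B ^ q) E) ⟨
    c * (6 * E) ^ e * (B ^ r * (q * B ^ q) ^ E)
      ≤⟨ ℕ.*-monoʳ-≤ (c * (6 * E) ^ e)
           (ℕ.*-mono-≤ (ℕ.^-monoˡ-≤ r (ℕ.<⇒≤ B<A)) (ℕ.^-monoˡ-≤ E (bernoulli B<A q))) ⟩
    c * (6 * E) ^ e * (A ^ r * (B * A ^ q) ^ E)
      ≡⟨ cong (λ x → c * (6 * E) ^ e * (A ^ r * x)) (^-distribʳ-* B (A ^ q) E) ⟩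
    c * (6 * E) ^ e * (A ^ r * (B ^ E * (A ^ q) ^ E))
      ≡⟨ solve 4 (λ x a b y → x :* (a :* (b :* y)) := x :* b :* (a :* y)) refl
           (c * (6 * E) ^ e) (A ^ r) (B ^ E) ((A ^ q) ^ E) ⟩
    K * (A ^ r * (A ^ q) ^ E)
      ≡⟨ cong (K *_) (split A) ⟨
    K * A ^ N
      <⟨ ℕ.*-monoˡ-< (A ^ N) {{ℕ.m^n≢0 A N}} K<q ⟩
    q * A ^ N ∎)
    where
    q = N / E
    r = N % E
    split : ∀ X → X ^ N ≡ X ^ r * (X ^ q) ^ E
    split X = trans (cong (X ^_) (ℕ.m≡m%n+[m/n]*n N E))
      (trans (ℕ.^-distribˡ-+-* X r (q * E)) (cong (X ^ r *_) (sym (ℕ.^-*-assoc X q E))))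
    K<q : K < q
    K<q = begin
      suc K               ≡⟨ ℕ.m*n/n≡m (suc K) E ⟨
      suc K * E / E       ≡⟨ cong (_/ E) (ℕ.*-comm (suc K) E) ⟩
      E * suc K / E       ≤⟨ ℕ./-monoˡ-≤ E N≥ ⟩
      N / E               ∎
    linear : 1 + 3 * N ≤ 6 * E * q
    linear = begin
      1 + 3 * N                  ≤⟨ ℕ.+-monoˡ-≤ (3 * N) {1} {3} (s≤s z≤n) ⟩
      3 + 3 * N                  ≡⟨ ℕ.*-suc 3 N ⟨
      3 * suc N                  ≡⟨ cong (λ n → 3 * suc n) (ℕ.m≡m%n+[m/n]*n N E) ⟩
      3 * (suc r + q * E)        ≤⟨ ℕ.*-monoʳ-≤ 3 (ℕ.+-monoˡ-≤ (q * E) (ℕ.m%n<n N E)) ⟩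
      3 * (E + q * E)            ≤⟨ ℕ.*-monoʳ-≤ 3 (ℕ.+-monoˡ-≤ (q * E) (ℕ.m≤n*m E q {{>-nonZero (ℕ.≤-<-trans z≤n K<q)}})) ⟩
      3 * (q * E + q * E)        ≡⟨ solve 2 (λ q E → con 3 :* (q :* E :+ q :* E) := con 6 :* E :* q) refl q E ⟩
      6 * E * q                  ∎

-- Decimal digits

-- Counting a zero digit as the factor 1 turns `nonzero-product` into a product over all digits.
nonzero : ℕ → ℕ
nonzero zero    = 1
nonzero (suc d) = suc d

nonzero-product : List ℕ → ℕ
nonzero-product w = product (filter (λ d → ¬? (d ℕ.≟ 0)) w)

nonzero-product-∷ : ∀ d w → nonzero-product (d ∷ w) ≡ nonzero d * nonzero-product w
nonzero-product-∷ zero    w = sym (ℕ.*-identityˡ _)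
nonzero-product-∷ (suc d) w = refl

nonzero-product-++ : ∀ u w → nonzero-product (u ++ w) ≡ nonzero-product u * nonzero-product w
nonzero-product-++ u w = trans (cong product (List.filter-++ _ u w)) (product-++ (filter _ u) (filter _ w))

digits : ℕ → List ℕ
digits = toNatDigits 10

append-digits : ℕ → List ℕ → ℕ
append-digits = foldl (λ n d → d + n * 10)

value : List ℕ → ℕ
value = append-digits 0

value-snoc : ∀ w d → value (w ++ d ∷ []) ≡ d + value w * 10
value-snoc w d = List.foldl-++ _ 0 w (d ∷ [])

digits-snoc : ∀ {q r} → 0 < q → r < 10 → digits (r + q * 10) ≡ digits q ++ r ∷ []
digits-snoc {q} {r} 0<q r<10 = trans (toNatDigits-≥ 10≤n)
  (cong₂ (λ x y → digits x ++ y ∷ []) /10 %10)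
  where
  10≤n : 10 ≤ r + q * 10
  10≤n = ℕ.≤-trans (ℕ.*-monoˡ-≤ 10 0<q) (ℕ.m≤n+m (q * 10) r)
  %10 : (r + q * 10) % 10 ≡ r
  %10 = trans (ℕ.[m+kn]%n≡m%n r q 10) (ℕ.m<n⇒m%n≡m r<10)
  /10 : (r + q * 10) / 10 ≡ q
  /10 = trans (ℕ.+-distrib-/-∣ʳ r (divides q refl))
    (cong₂ _+_ (ℕ.m<n⇒m/n≡0 r<10) (ℕ.m*n/n≡m q 10))

-- Every `n ≥ 10` is its last digit plus ten times a smaller positive number; the step is phrased so
-- as to match `digits-snoc`.
digit-induction : (P : ℕ → Set) → (∀ {n} → n < 10 → P n) →
                  (∀ {q r} → 0 < q → r < 10 → P q → P (r + q * 10)) → ∀ n → P n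
digit-induction P base step = <-rec P go
  where
  go : ∀ n → (∀ {m} → m < n → P m) → P n
  go n ih with n ℕ.<? 10
  ... | yes n<10 = base n<10
  ... | no  n≮10 = subst P (sym (ℕ.m≡m%n+[m/n]*n n 10))
    (step (ℕ.m≥n⇒m/n>0 n≥10) (ℕ.m%n<n n 10) (ih (ℕ.m/n<m n 10 {{n≢0}} (s≤s (s≤s z≤n)))))
    where
    n≥10 = ℕ.≮⇒≥ n≮10
    n≢0 = >-nonZero (ℕ.≤-trans (s≤s z≤n) n≥10)

value-digits : ∀ n → value (digits n) ≡ n
value-digits = digit-induction _ base step
  where
  base : ∀ {n} → n < 10 → value (digits n) ≡ n
  base {n} n<10 = trans (cong value (toNatDigits-< n<10)) (ℕ.+-identityʳ n)
  step : ∀ {q r} → 0 < q → r < 10 → value (digits q) ≡ q → value (digits (r + q * 10)) ≡ r + q * 10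
  step {q} {r} 0<q r<10 ih = trans (cong value (digits-snoc 0<q r<10))
    (trans (value-snoc (digits q) r) (cong (λ m → r + m * 10) ih))

digits-injective : ∀ {m n} → digits m ≡ digits n → m ≡ n
digits-injective {m} {n} eq = trans (sym (value-digits m)) (trans (cong value eq) (value-digits n))

digits-<10 : ∀ n → All (_< 10) (digits n)
digits-<10 = digit-induction _
  (λ n<10 → subst (All (_< 10)) (sym (toNatDigits-< n<10)) (n<10 ∷ []))
  (λ 0<q r<10 ih → subst (All (_< 10)) (sym (digits-snoc 0<q r<10)) (All.++⁺ ih (r<10 ∷ [])))

length-snoc : ∀ (w : List ℕ) d → length (w ++ d ∷ []) ≡ suc (length w)
length-snoc w d = trans (List.length-++ w) (ℕ.+-comm (length w) 1)

n<10^length-digits : ∀ n → n < 10 ^ length (digits n)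
n<10^length-digits = digit-induction _ base step
  where
  base : ∀ {n} → n < 10 → n < 10 ^ length (digits n)
  base {n} n<10 = subst (λ w → n < 10 ^ length w) (sym (toNatDigits-< n<10)) n<10
  step : ∀ {q r} → 0 < q → r < 10 → q < 10 ^ length (digits q) →
         r + q * 10 < 10 ^ length (digits (r + q * 10))
  step {q} {r} 0<q r<10 ih = begin-strict
    r + q * 10                            <⟨ ℕ.+-monoˡ-< (q * 10) r<10 ⟩
    suc q * 10                            ≤⟨ ℕ.*-monoˡ-≤ 10 ih ⟩
    10 ^ length (digits q) * 10           ≡⟨ ℕ.*-comm (10 ^ length (digits q)) 10 ⟩
    10 ^ suc (length (digits q))          ≡⟨ cong (10 ^_) (length-snoc (digits q) r) ⟨
    10 ^ length (digits q ++ r ∷ [])      ≡⟨ cong (λ w → 10 ^ length w) (digits-snoc 0<q r<10) ⟨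
    10 ^ length (digits (r + q * 10))     ∎
    where open ℕ.≤-Reasoning

-- Stripping the last digit lowers the exponent by one, so `N` is quantified inside the induction.
-- The exponent is a successor because even 0 has one digit.
length-digits≤ : ∀ {N} n → n < 10 ^ suc N → length (digits n) ≤ suc N
length-digits≤ {N} n = digit-induction (λ n → ∀ {N} → n < 10 ^ suc N → length (digits n) ≤ suc N) base step n {N}
  where
  base : ∀ {n} → n < 10 → ∀ {N} → n < 10 ^ suc N → length (digits n) ≤ suc N
  base n<10 _ = subst (_≤ _) (cong length (sym (toNatDigits-< n<10))) (s≤s z≤n)
  step : ∀ {q r} → 0 < q → r < 10 → (∀ {N} → q < 10 ^ suc N → length (digits q) ≤ suc N) →
         ∀ {N} → r + q * 10 < 10 ^ suc N → length (digits (r + q * 10)) ≤ suc N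
  step {q} {r} 0<q r<10 ih {zero}  n<10 =
    contradiction n<10 (ℕ.≤⇒≯ (ℕ.≤-trans (ℕ.*-monoˡ-≤ 10 0<q) (ℕ.m≤n+m (q * 10) r)))
  step {q} {r} 0<q r<10 ih {suc N} n<10^ =
    subst (_≤ suc (suc N)) (sym (trans (cong length (digits-snoc 0<q r<10)) (length-snoc (digits q) r)))
      (s≤s (ih (ℕ.*-cancelʳ-< 10 q _ (ℕ.≤-<-trans (ℕ.m≤n+m (q * 10) r)
        (subst (r + q * 10 <_) (ℕ.*-comm 10 (10 ^ suc N)) n<10^)))))

Divisible : (ℕ → ℕ) → ℕ → Set
Divisible p n = 0 < n × p n ∣ n

-- A real x is only located between integers m < x < 2 + m, hence the shifts by 1
-- and 2.
UpperCount LowerCount : (ℕ → ℕ) → ℕ → ℕ → Set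
UpperCount p e d = ∃ λ M → ∀ {m ns} → M ≤ m → Unique ns →
  (∀ {n} → n ∈ ns → n ≤ 1 + m × Divisible p n) → length ns ^ d < m ^ e
LowerCount p e d = ∃ λ M → ∀ {m} → M ≤ m → ∃ λ ns → Unique ns ×
  (∀ {n} → n ∈ ns → n ≤ m × Divisible p n) × (2 + m) ^ e < length ns ^ d

-- Words with digit weights and 7-smooth numbers

weight : (ℕ → ℕ) → List ℕ → ℕ
weight v w = product (map v w)

words : List ℕ → ℕ → List (List ℕ)
words ds zero    = [] ∷ []
words ds (suc j) = cartesianProductWith _∷_ ds (words ds j)

∈-words : ∀ {ds w} → All (_∈ ds) w → w ∈ words ds (length w)
∈-words []         = here refl
∈-words (d∈ ∷ w∈) = ∈-cartesianProductWith⁺ _∷_ d∈ (∈-words w∈)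

-- Distributivity: expanding the `j`-th power of the digit sum produces one product of weights for
-- each word.
sum-weight-words : ∀ v ds j → sum (map (weight v) (words ds j)) ≡ sum (map v ds) ^ j
sum-weight-words v ds zero    = refl
sum-weight-words v ds (suc j) = trans (extend ds) (cong (sum (map v ds) *_) (sum-weight-words v ds j))
  where
  open ≡-Reasoning
  ws = words ds j
  prefix : ∀ d us → sum (map (weight v) (map (d ∷_) us)) ≡ v d * sum (map (weight v) us)
  prefix d []       = sym (ℕ.*-zeroʳ (v d))
  prefix d (u ∷ us) = trans (cong (v d * weight v u +_) (prefix d us))
    (sym (ℕ.*-distribˡ-+ (v d) (weight v u) _))
  extend : ∀ es → sum (map (weight v) (cartesianProductWith _∷_ es ws)) ≡
                  sum (map v es) * sum (map (weight v) ws)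
  extend []       = refl
  extend (d ∷ es) = begin
    sum (map (weight v) (map (d ∷_) ws ++ cartesianProductWith _∷_ es ws))
      ≡⟨ sum-map-++ (weight v) (map (d ∷_) ws) _ ⟩
    sum (map (weight v) (map (d ∷_) ws)) + sum (map (weight v) (cartesianProductWith _∷_ es ws))
      ≡⟨ cong₂ _+_ (prefix d ws) (extend es) ⟩
    v d * sum (map (weight v) ws) + sum (map v es) * sum (map (weight v) ws)
      ≡⟨ ℕ.*-distribʳ-+ (sum (map (weight v) ws)) (v d) (sum (map v es)) ⟨
    (v d + sum (map v es)) * sum (map (weight v) ws) ∎

-- A positive multiple of `D` up to `X` is `suc i * D` with `i < X / D`, which leaves `X / D`
-- candidates.
count-multiples : ∀ D .{{_ : NonZero D}} X {ns} → Unique ns →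
                  (∀ {n} → n ∈ ns → 0 < n × n ≤ X × D ∣ n) → length ns * D ≤ X
count-multiples D X {ns} ns! multiple = begin
  length ns * D                                      ≤⟨ ℕ.*-monoˡ-≤ D (Unique-⊆⇒length≤ ns! listed) ⟩
  length (map multiples (upTo (X / D))) * D          ≡⟨ cong (_* D) (trans (List.length-map multiples (upTo (X / D))) (List.length-upTo (X / D))) ⟩
  X / D * D                                          ≤⟨ ℕ.m/n*n≤m X D ⟩
  X                                                  ∎
  where
  open ℕ.≤-Reasoning
  multiples : ℕ → ℕ
  multiples i = suc i * D
  listed : ∀ {n} → n ∈ ns → n ∈ map multiples (upTo (X / D))
  listed n∈ with multiple n∈
  ... | 0<n , n≤X , divides zero    refl = contradiction 0<n ℕ.n≮0
  ... | 0<n , n≤X , divides (suc i) refl = ∈-map⁺ multiples (∈-upTo⁺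
    (subst (_≤ X / D) (ℕ.m*n/n≡m (suc i) D) (ℕ./-monoˡ-≤ D n≤X)))

-- `N` stands for a number of digits: no nonzero digit contains a prime more than three times, 8
-- being the extreme case. The final factor 1 matches the empty product in `power-products`.
record Smooth (N n : ℕ) : Set where
  constructor smooth
  field
    i j k l : ℕ
    i≤ : i ≤ 3 * N
    j≤ : j ≤ 3 * N
    k≤ : k ≤ 3 * N
    l≤ : l ≤ 3 * N
    factorisation : n ≡ 2 ^ i * (3 ^ j * (5 ^ k * (7 ^ l * 1)))

smooth-1 : Smooth 0 1
smooth-1 = smooth 0 0 0 0 z≤n z≤n z≤n z≤n refl

smooth-* : ∀ {M N m n} → Smooth M m → Smooth N n → Smooth (M + N) (m * n)
smooth-* {M} {N} (smooth i j k l i≤ j≤ k≤ l≤ refl) (smooth i′ j′ k′ l′ i′≤ j′≤ k′≤ l′≤ refl) =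
  smooth (i + i′) (j + j′) (k + k′) (l + l′) (add i≤ i′≤) (add j≤ j′≤) (add k≤ k′≤) (add l≤ l′≤)
    (trans
      (solve 8 (λ a b c d x y z w → a :* (b :* (c :* (d :* con 1))) :* (x :* (y :* (z :* (w :* con 1)))) :=
                                    a :* x :* (b :* y :* (c :* z :* (d :* w :* con 1)))) refl
        (2 ^ i) (3 ^ j) (5 ^ k) (7 ^ l) (2 ^ i′) (3 ^ j′) (5 ^ k′) (7 ^ l′))
      (sym (cong₂ _*_ (ℕ.^-distribˡ-+-* 2 i i′) (cong₂ _*_ (ℕ.^-distribˡ-+-* 3 j j′)
        (cong₂ _*_ (ℕ.^-distribˡ-+-* 5 k k′) (cong (_* 1) (ℕ.^-distribˡ-+-* 7 l l′)))))))
  where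
  open +-*-Solver
  add : ∀ {x y} → x ≤ 3 * M → y ≤ 3 * N → x + y ≤ 3 * (M + N)
  add x≤ y≤ = ℕ.≤-trans (ℕ.+-mono-≤ x≤ y≤) (ℕ.≤-reflexive (sym (ℕ.*-distribˡ-+ 3 M N)))

smooth-mono : ∀ {M N n} → M ≤ N → Smooth M n → Smooth N n
smooth-mono {M} {N} M≤N (smooth i j k l i≤ j≤ k≤ l≤ eq) = smooth i j k l (up i≤) (up j≤) (up k≤) (up l≤) eq
  where
  up : ∀ {x} → x ≤ 3 * M → x ≤ 3 * N
  up x≤ = ℕ.≤-trans x≤ (ℕ.*-monoʳ-≤ 3 M≤N)

smooth-digit : ∀ {d} → d < 10 → Smooth 1 (nonzero d)
smooth-digit {d} d<10 = All.lookup table (∈-upTo⁺ d<10)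
  where
  table : All (λ d → Smooth 1 (nonzero d)) (upTo 10)
  table = by 0 0 0 0 ∷ by 0 0 0 0 ∷ by 1 0 0 0 ∷ by 0 1 0 0 ∷ by 2 0 0 0 ∷
          by 0 0 1 0 ∷ by 1 1 0 0 ∷ by 0 0 0 1 ∷ by 3 0 0 0 ∷ by 0 2 0 0 ∷ []
    where
    by : ∀ i j k l {_ : True (i ℕ.≤? 3)} {_ : True (j ℕ.≤? 3)} {_ : True (k ℕ.≤? 3)} {_ : True (l ℕ.≤? 3)} →
         Smooth 1 (2 ^ i * (3 ^ j * (5 ^ k * (7 ^ l * 1))))
    by i j k l {i≤} {j≤} {k≤} {l≤} =
      smooth i j k l (toWitness i≤) (toWitness j≤) (toWitness k≤) (toWitness l≤) refl

smooth-nonzero-product : ∀ {w} → All (_< 10) w → Smooth (length w) (nonzero-product w)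
smooth-nonzero-product []                         = smooth-1
smooth-nonzero-product {d ∷ w} (d<10 ∷ w<10) = subst (Smooth _) (sym (nonzero-product-∷ d w))
  (smooth-* (smooth-digit d<10) (smooth-nonzero-product w<10))

powers : ℕ → ℕ → List ℕ
powers N p = map (p ^_) (upTo (1 + 3 * N))

power-products : ℕ → List ℕ → List ℕ
power-products N []       = 1 ∷ []
power-products N (p ∷ ps) = cartesianProductWith _*_ (powers N p) (power-products N ps)

length-power-products : ∀ N ps → length (power-products N ps) ≡ (1 + 3 * N) ^ length ps
length-power-products N []       = refl
length-power-products N (p ∷ ps) = trans
  (length-cartesianProductWith _*_ (powers N p) (power-products N ps))
  (cong₂ _*_ length-powers (length-power-products N ps))
  where
  length-powers : length (powers N p) ≡ 1 + 3 * N
  length-powers = trans (List.length-map (p ^_) (upTo (1 + 3 * N))) (List.length-upTo (1 + 3 * N))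

smooths : ℕ → List ℕ
smooths N = power-products N (2 ∷ 3 ∷ 5 ∷ 7 ∷ [])

∈-smooths : ∀ {N n} → Smooth N n → n ∈ smooths N
∈-smooths {N} (smooth i j k l i≤ j≤ k≤ l≤ refl) =
  mul (pow 2 i≤) (mul (pow 3 j≤) (mul (pow 5 k≤) (mul (pow 7 l≤) (here refl))))
  where
  mul = ∈-cartesianProductWith⁺ _*_
  pow : ∀ p {i} → i ≤ 3 * N → p ^ i ∈ powers N p
  pow p i≤ = ∈-map⁺ (p ^_) (∈-upTo⁺ (s≤s i≤))

-- Upper bounds

0^n≡0 : ∀ n .{{_ : NonZero n}} → 0 ^ n ≡ 0
0^n≡0 (suc n) = refl

signatures : ℕ → List (ℕ × ℕ)
signatures N = cartesianProduct (upTo (1 + N)) (smooths N)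

-- There are `1 + N` lengths and four exponents with `1 + 3 * N` values each; enlarging the first
-- factor gives a single power.
length-signatures : ∀ N → length (signatures N) ≤ (1 + 3 * N) ^ 5
length-signatures N = begin
  length (signatures N)                    ≡⟨ length-cartesianProductWith _,_ (upTo (1 + N)) (smooths N) ⟩
  length (upTo (1 + N)) * length (smooths N)
    ≡⟨ cong₂ _*_ (List.length-upTo (1 + N)) (length-power-products N (2 ∷ 3 ∷ 5 ∷ 7 ∷ [])) ⟩
  (1 + N) * (1 + 3 * N) ^ 4                ≤⟨ ℕ.*-monoˡ-≤ ((1 + 3 * N) ^ 4) (s≤s (ℕ.m≤n*m N 3)) ⟩
  (1 + 3 * N) ^ 5                          ∎
  where open ℕ.≤-Reasoning

signature : ℕ → ℕ × ℕ
signature n = length (digits n) , nonzero-product (digits n)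

signature∈signatures : ∀ {N n} → length (digits n) ≤ N → signature n ∈ signatures N
signature∈signatures {N} {n} len≤ = ∈-cartesianProduct⁺
  (∈-upTo⁺ (s≤s len≤))
  (∈-smooths (smooth-mono len≤ (smooth-nonzero-product (digits-<10 n))))

_≟²_ : DecidableEquality (ℕ × ℕ)
_≟²_ = ≡-dec ℕ._≟_ ℕ._≟_

-- v d / Q is a rational majorant of d ^ (- b / a) for the nonzero digits d.
module UpperBound
  (ds : List ℕ) (v : ℕ → ℕ) (Q a b e k : ℕ) .{{_ : NonZero a}}
  (v-large : All (λ d → Q ^ a ≤ v d ^ a * nonzero d ^ b) ds)
  -- In the notation below this is `X ≤ Y`, which pads the estimate for shorter numbers to full
  -- length.
  (Qᵃ≤ : Q ^ a ≤ 10 ^ b * sum (map v ds) ^ a)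
  -- Per digit, the `(a + b)`-th power of the count grows by the factor `Y / X`, whose `k`-th power
  -- has to stay below `10 ^ (e * (a + b))`.
  (gap : (10 ^ b * sum (map v ds) ^ a) ^ k < 10 ^ (e * (a + b)) * (Q ^ a) ^ k)
  where

  open ℕ.≤-Reasoning

  private
    S = sum (map v ds)
    X = Q ^ a
    Y = 10 ^ b * S ^ a
    V : ℕ → ℕ
    V n = weight v (digits n)

    instance
      a+b≢0 : NonZero (a + b)
      a+b≢0 = >-nonZero (ℕ.≤-trans (>-nonZero⁻¹ a) (ℕ.m≤m+n a b))

  Admissible : ℕ → Set
  Admissible n = 0 < n × All (_∈ ds) (digits n) × nonzero-product (digits n) ∣ n

  -- The majorant `v d / Q` is multiplied over the digits, with `a`-th powers taken to stay among
  -- integers.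
  weight-large : ∀ {w} → All (_∈ ds) w → X ^ length w ≤ weight v w ^ a * nonzero-product w ^ b
  weight-large {[]}    []         = ℕ.≤-reflexive (sym (cong₂ _*_ (ℕ.^-zeroˡ a) (ℕ.^-zeroˡ b)))
  weight-large {d ∷ w} (d∈ ∷ w∈) = begin
    X * X ^ length w
      ≤⟨ ℕ.*-mono-≤ (All.lookup v-large d∈) (weight-large w∈) ⟩
    v d ^ a * nonzero d ^ b * (weight v w ^ a * nonzero-product w ^ b)
      ≡⟨ ℕ.[m*n]*[o*p]≡[m*o]*[n*p] (v d ^ a) (nonzero d ^ b) (weight v w ^ a) (nonzero-product w ^ b) ⟩
    v d ^ a * weight v w ^ a * (nonzero d ^ b * nonzero-product w ^ b)
      ≡⟨ cong₂ _*_ (^-distribʳ-* (v d) (weight v w) a) (^-distribʳ-* (nonzero d) (nonzero-product w) b) ⟨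
    (v d * weight v w) ^ a * (nonzero d * nonzero-product w) ^ b
      ≡⟨ cong (λ x → (v d * weight v w) ^ a * x ^ b) (nonzero-product-∷ d w) ⟨
    weight v (d ∷ w) ^ a * nonzero-product (d ∷ w) ^ b ∎

  -- The class has total weight at most `S ^ j`, which bounds `c` times its least weight, and it
  -- consists of multiples of `D`. In the `a`-th power of the first bound times the `b`-th power of
  -- the second, `weight-large` eliminates both that weight and `D`.
  class-bound : ∀ {j D ns} → Unique ns →
                (∀ {n} → n ∈ ns → Admissible n × signature n ≡ (j , D)) →
                length ns ^ (a + b) * X ^ j ≤ Y ^ j
  class-bound {j} {ns = []} _ _ = subst (λ x → x * X ^ j ≤ Y ^ j)
    (sym (0^n≡0 (a + b))) z≤n
  class-bound {j} {D} {ns@(m ∷ _)} ns! class = begin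
    c ^ (a + b) * X ^ j                        ≡⟨ cong (_* X ^ j) (ℕ.^-distribˡ-+-* c a b) ⟩
    c ^ a * c ^ b * X ^ j                      ≤⟨ ℕ.*-monoʳ-≤ (c ^ a * c ^ b) X^j≤ ⟩
    c ^ a * c ^ b * (V n ^ a * D ^ b)          ≡⟨ ℕ.[m*n]*[o*p]≡[m*o]*[n*p] (c ^ a) (c ^ b) (V n ^ a) (D ^ b) ⟩
    c ^ a * V n ^ a * (c ^ b * D ^ b)          ≡⟨ cong₂ _*_ (^-distribʳ-* c (V n) a) (^-distribʳ-* c D b) ⟨
    (c * V n) ^ a * (c * D) ^ b                ≤⟨ ℕ.*-mono-≤ (ℕ.^-monoˡ-≤ a cV≤) (ℕ.^-monoˡ-≤ b cD≤) ⟩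
    (S ^ j) ^ a * (10 ^ j) ^ b                 ≡⟨ ℕ.*-comm ((S ^ j) ^ a) ((10 ^ j) ^ b) ⟩
    (10 ^ j) ^ b * (S ^ j) ^ a                 ≡⟨ cong₂ _*_ (^-swap 10 j b) (^-swap S j a) ⟩
    (10 ^ b) ^ j * (S ^ a) ^ j                 ≡⟨ ^-distribʳ-* (10 ^ b) (S ^ a) j ⟨
    Y ^ j                                      ∎
    where
    c = length ns
    -- Rounding in `v` may give members with the same `D` different weights, so the lightest one
    -- represents them all.
    lightest = length*min≤sum V {m} {ns} (here refl)
    n = proj₁ lightest
    n∈ns = proj₁ (proj₂ lightest)
    len : ∀ {n} → n ∈ ns → length (digits n) ≡ j
    len n∈ = cong proj₁ (proj₂ (class n∈))
    prod : ∀ {n} → n ∈ ns → nonzero-product (digits n) ≡ D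
    prod n∈ = cong proj₂ (proj₂ (class n∈))
    D∣ : ∀ {n} → n ∈ ns → D ∣ n
    D∣ {n} n∈ = subst (_∣ n) (prod n∈) (proj₂ (proj₂ (proj₁ (class n∈))))
    X^j≤ : X ^ j ≤ V n ^ a * D ^ b
    X^j≤ = subst₂ (λ i x → X ^ i ≤ V n ^ a * x ^ b) (len n∈ns) (prod n∈ns)
      (weight-large (proj₁ (proj₂ (proj₁ (class n∈ns)))))
    in-words : ∀ {w} → w ∈ map digits ns → w ∈ words ds j
    in-words w∈ with n , n∈ , refl ← ∈-map⁻ digits w∈ =
      subst (λ i → digits n ∈ words ds i) (len n∈) (∈-words (proj₁ (proj₂ (proj₁ (class n∈)))))
    cV≤ : c * V n ≤ S ^ j
    cV≤ = begin
      c * V n                                   ≤⟨ proj₂ (proj₂ lightest) ⟩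
      sum (map V ns)                            ≡⟨ cong sum (List.map-∘ ns) ⟩
      sum (map (weight v) (map digits ns))      ≤⟨ Unique-⊆⇒sum≤ (weight v) (Unique.map⁺ digits-injective ns!) in-words ⟩
      sum (map (weight v) (words ds j))         ≡⟨ sum-weight-words v ds j ⟩
      S ^ j                                     ∎
    cD≤ : c * D ≤ 10 ^ j
    cD≤ = count-multiples D {{D≢0}} (10 ^ j) ns! λ {n} n∈ →
      proj₁ (proj₁ (class n∈)) ,
      subst (λ i → n ≤ 10 ^ i) (len n∈) (ℕ.<⇒≤ (n<10^length-digits n)) ,
      D∣ n∈
      where
      D≢0 : NonZero D
      D≢0 = ≢-nonZero λ where
        refl → ℕ.<-irrefl (sym (ℕ.0∣⇒≡0 (D∣ (here refl)))) (proj₁ (proj₁ (class (here refl))))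

  -- Passing to the most frequent signature loses only a factor `R`. Its length `j` may be smaller
  -- than `M`; the missing `M ∸ j` factors are supplied by `X ≤ Y`.
  count-bound : ∀ {M R ns} → length (signatures M) ≤ R → Unique ns →
                (∀ {n} → n ∈ ns → length (digits n) ≤ M × Admissible n) →
                length ns ^ (a + b) * X ^ M ≤ R ^ (a + b) * Y ^ M
  count-bound {M} {R} {[]} _ _ _ = subst (λ x → x * X ^ M ≤ R ^ (a + b) * Y ^ M)
    (sym (0^n≡0 (a + b))) z≤n
  count-bound {M} {R} {ns@(m ∷ _)} R≥ ns! ok = begin
    c ^ (a + b) * X ^ M
      ≤⟨ ℕ.*-monoˡ-≤ (X ^ M) (ℕ.^-monoˡ-≤ (a + b) (ℕ.≤-trans (proj₂ (proj₂ popular)) (ℕ.*-monoˡ-≤ c′ R≥))) ⟩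
    (R * c′) ^ (a + b) * X ^ M
      ≡⟨ cong₂ _*_ (^-distribʳ-* R c′ (a + b)) (split X) ⟩
    R ^ (a + b) * c′ ^ (a + b) * (X ^ j * X ^ (M ∸ j))
      ≡⟨ rearrange (R ^ (a + b)) (c′ ^ (a + b)) (X ^ j) (X ^ (M ∸ j)) ⟩
    R ^ (a + b) * (c′ ^ (a + b) * X ^ j * X ^ (M ∸ j))
      ≤⟨ ℕ.*-monoʳ-≤ (R ^ (a + b)) (ℕ.*-mono-≤ (class-bound {j} {D} {class} (Unique.filter⁺ same? ns!) classified)
           (ℕ.^-monoˡ-≤ (M ∸ j) Qᵃ≤)) ⟩
    R ^ (a + b) * (Y ^ j * Y ^ (M ∸ j))
      ≡⟨ cong (R ^ (a + b) *_) (split Y) ⟨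
    R ^ (a + b) * Y ^ M ∎
    where
    c = length ns
    sig∈ : ∀ {n} → n ∈ ns → signature n ∈ signatures M
    sig∈ {n} n∈ = signature∈signatures {M} {n} (proj₁ (ok n∈))
    popular = pigeonhole _≟²_ signature (sig∈ (here refl)) ns! sig∈
    j = proj₁ (proj₁ popular)
    D = proj₂ (proj₁ popular)
    same? = λ n → signature n ≟² (j , D)
    class = filter same? ns
    c′ = length class
    j≤M : j ≤ M
    j≤M = ℕ.≤-pred (∈-upTo⁻ (proj₁ (∈-cartesianProduct⁻ (upTo (1 + M)) (smooths M) (proj₁ (proj₂ popular)))))
    rearrange : ∀ p c x y → p * c * (x * y) ≡ p * (c * x * y)
    rearrange = solve 4 (λ p c x y → p :* c :* (x :* y) := p :* (c :* x :* y)) refl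
      where open +-*-Solver
    split : ∀ Z → Z ^ M ≡ Z ^ j * Z ^ (M ∸ j)
    split Z = trans (cong (Z ^_) (sym (ℕ.m+[n∸m]≡n j≤M))) (ℕ.^-distribˡ-+-* Z j (M ∸ j))
    classified : ∀ {n} → n ∈ class → Admissible n × signature n ≡ (j , D)
    classified n∈ = let n∈ns , eq = ∈-filter⁻ same? {xs = ns} n∈ in proj₂ (ok n∈ns) , eq

  private
    -- The constant comes from `10 ^ N′ ≤ 20 * m`, and the degree in `beats` from the at most
    -- `(1 + 3 * N′) ^ 5` signatures, raised to the powers `a + b` and `k`.
    K = (20 ^ e) ^ (a + b)
    beats = polynomial<exponential K (5 * (a + b) * k) gap

  -- If `m ^ e ≤ c ^ k`, then `count-bound` contradicts `gap`, whose exponential advantage outweighs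
  -- the polynomial number of signatures and the constant `K`.
  upper-bound : ∃ λ M → ∀ {m ns} → M ≤ m → Unique ns →
                (∀ {n} → n ∈ ns → n ≤ suc m × Admissible n) → length ns ^ k < m ^ e
  upper-bound = 10 ^ proj₁ beats , bound
    where
    bound : ∀ {m ns} → 10 ^ proj₁ beats ≤ m → Unique ns →
            (∀ {n} → n ∈ ns → n ≤ suc m × Admissible n) → length ns ^ k < m ^ e
    bound {m} {ns} M≤m ns! ok = ℕ.≰⇒> λ mᵉ≤cᵏ → ℕ.<-irrefl refl (begin-strict
        (10 ^ (e * (a + b)) * X ^ k) ^ N′
          ≡⟨ ^-distribʳ-* (10 ^ (e * (a + b))) (X ^ k) N′ ⟩
        (10 ^ (e * (a + b))) ^ N′ * (X ^ k) ^ N′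
          ≡⟨ cong₂ _*_ exponents (^-swap X k N′) ⟩
        ((10 ^ N′) ^ e) ^ (a + b) * (X ^ N′) ^ k
          ≤⟨ ℕ.*-monoˡ-≤ _ (ℕ.^-monoˡ-≤ (a + b) (ℕ.^-monoˡ-≤ e 10^N′≤)) ⟩
        ((20 * m) ^ e) ^ (a + b) * (X ^ N′) ^ k
          ≡⟨ cong (λ x → x ^ (a + b) * (X ^ N′) ^ k) (^-distribʳ-* 20 m e) ⟩
        (20 ^ e * m ^ e) ^ (a + b) * (X ^ N′) ^ k
          ≤⟨ ℕ.*-monoˡ-≤ _ (ℕ.^-monoˡ-≤ (a + b) (ℕ.*-monoʳ-≤ (20 ^ e) mᵉ≤cᵏ)) ⟩
        (20 ^ e * c ^ k) ^ (a + b) * (X ^ N′) ^ k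
          ≡⟨ cong (_* (X ^ N′) ^ k) (^-distribʳ-* (20 ^ e) (c ^ k) (a + b)) ⟩
        K * (c ^ k) ^ (a + b) * (X ^ N′) ^ k
          ≡⟨ cong (λ x → K * x * (X ^ N′) ^ k) (^-swap c k (a + b)) ⟩
        K * (c ^ (a + b)) ^ k * (X ^ N′) ^ k
          ≡⟨ ℕ.*-assoc K _ _ ⟩
        K * ((c ^ (a + b)) ^ k * (X ^ N′) ^ k)
          ≡⟨ cong (K *_) (^-distribʳ-* (c ^ (a + b)) (X ^ N′) k) ⟨
        K * (c ^ (a + b) * X ^ N′) ^ k
          ≤⟨ ℕ.*-monoʳ-≤ K (ℕ.^-monoˡ-≤ k (count-bound {N′} {R} {ns} (length-signatures N′) ns! ok′)) ⟩
        K * (R ^ (a + b) * Y ^ N′) ^ k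
          ≡⟨ cong (K *_) (^-distribʳ-* (R ^ (a + b)) (Y ^ N′) k) ⟩
        K * ((R ^ (a + b)) ^ k * (Y ^ N′) ^ k)
          ≡⟨ cong₂ (λ x y → K * (x * y)) R-power (^-swap Y N′ k) ⟩
        K * ((1 + 3 * N′) ^ (5 * (a + b) * k) * (Y ^ k) ^ N′)
          ≡⟨ ℕ.*-assoc K _ _ ⟨
        K * (1 + 3 * N′) ^ (5 * (a + b) * k) * (Y ^ k) ^ N′
          <⟨ proj₂ beats N₀≤N′ ⟩
        (10 ^ (e * (a + b)) * X ^ k) ^ N′ ∎)
      where
      -- This gives `N` with `10 ^ N ≤ m + 1 < 10 ^ (N + 1)`, so numbers up to `m + 1` have at most
      -- `N′` digits.
      digit-count = crossing (λ N → suc m ℕ.<? 10 ^ N) (λ where (s≤s ())) (suc m) (n<m^n (s≤s (s≤s z≤n)) (suc m))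
      N = proj₁ digit-count
      m+1≮ = proj₁ (proj₂ digit-count)
      m+1< = proj₂ (proj₂ digit-count)
      N′ = suc N
      R = (1 + 3 * N′) ^ 5
      R-power : (R ^ (a + b)) ^ k ≡ (1 + 3 * N′) ^ (5 * (a + b) * k)
      R-power = trans (cong (_^ k) (ℕ.^-*-assoc (1 + 3 * N′) 5 (a + b))) (ℕ.^-*-assoc (1 + 3 * N′) (5 * (a + b)) k)
      ok′ : ∀ {n} → n ∈ ns → length (digits n) ≤ N′ × Admissible n
      ok′ {n} n∈ = length-digits≤ n (ℕ.≤-<-trans (proj₁ (ok n∈)) m+1<) , proj₂ (ok n∈)
      c = length ns
      exponents : (10 ^ (e * (a + b))) ^ N′ ≡ ((10 ^ N′) ^ e) ^ (a + b)
      exponents = trans (^-swap 10 (e * (a + b)) N′) (sym (ℕ.^-*-assoc (10 ^ N′) e (a + b)))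
      1≤m : 1 ≤ m
      1≤m = ℕ.≤-trans (ℕ.m^n>0 10 (proj₁ beats)) M≤m
      10^N′≤ : 10 ^ N′ ≤ 20 * m
      10^N′≤ = begin
        10 * 10 ^ N        ≤⟨ ℕ.*-monoʳ-≤ 10 (ℕ.≮⇒≥ m+1≮) ⟩
        10 * (1 + m)       ≤⟨ ℕ.*-monoʳ-≤ 10 (ℕ.+-monoˡ-≤ m 1≤m) ⟩
        10 * (m + m)       ≡⟨ solve 1 (λ m → con 10 :* (m :+ m) := con 20 :* m) refl m ⟩
        20 * m             ∎
        where open +-*-Solver
      N₀≤N′ : proj₁ beats ≤ N′
      N₀≤N′ = ℕ.<⇒≤ (ℕ.≰⇒> λ N′≤ → ℕ.<-irrefl refl (begin-strict
        suc m                  <⟨ m+1< ⟩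
        10 ^ N′                ≤⟨ ℕ.^-monoʳ-≤ 10 N′≤ ⟩
        10 ^ proj₁ beats       ≤⟨ M≤m ⟩
        m                      ≤⟨ ℕ.n≤1+n m ⟩
        suc m                  ∎))

-- d ↦ ⌈10⁴ d^(-13/10)⌉ for d > 0
weight₀ : ℕ → ℕ
weight₀ 0 = 10000
weight₀ 1 = 10000
weight₀ 2 = 4062
weight₀ 3 = 2398
weight₀ 4 = 1650
weight₀ 5 = 1235
weight₀ 6 = 974
weight₀ 7 = 797
weight₀ 8 = 670
weight₀ 9 = 575
weight₀ _ = 0

-- d ↦ ⌈10⁴ d^(-7/5)⌉
weight₁ : ℕ → ℕ
weight₁ 1 = 10000
weight₁ 2 = 3790
weight₁ 3 = 2148
weight₁ 4 = 1436
weight₁ 5 = 1051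
weight₁ 6 = 814
weight₁ 7 = 656
weight₁ 8 = 545
weight₁ 9 = 462
weight₁ _ = 0

all-digits nonzero-digits : List ℕ
all-digits     = upTo 10
nonzero-digits = map suc (upTo 9)

abstract
  𝒩₁₀,₀-upper : UpperCount p₁₀,₀ 787 1000
  𝒩₁₀,₀-upper = proj₁ upper-bound , λ M≤m ns! ok → proj₂ upper-bound M≤m ns! λ {n} n∈ →
    proj₁ (ok n∈) , proj₁ (proj₂ (ok n∈)) , All.map ∈-upTo⁺ (digits-<10 n) , proj₂ (proj₂ (ok n∈))
    where
    -- The three closed inequalities are settled by evaluation. The growth exponent obtained is
    -- about 0.78697, so `b / a` = 13/10 and the rounded weights leave just enough room.
    open UpperBound all-digits weight₀ 10000 10 13 787 1000
      (toWitness {a? = All.all? (λ d → 10000 ^ 10 ℕ.≤? weight₀ d ^ 10 * nonzero d ^ 13) all-digits} _)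
      (toWitness {a? = 10000 ^ 10 ℕ.≤? 10 ^ 13 * sum (map weight₀ all-digits) ^ 10} _)
      (toWitness {a? = (10 ^ 13 * sum (map weight₀ all-digits) ^ 10) ^ 1000 ℕ.<? 10 ^ (787 * 23) * (10000 ^ 10) ^ 1000} _)

  𝒩₁₀-upper : UpperCount p₁₀ 717 1000
  𝒩₁₀-upper = proj₁ upper-bound , λ M≤m ns! ok → proj₂ upper-bound M≤m ns! λ {n} n∈ →
    let n≤ , 0<n , p∣n = ok n∈ ; d≢0 = no-zeros 0<n p∣n in
    n≤ , 0<n , All.zipWith nonzero-digit (d≢0 , digits-<10 n) ,
    subst (_∣ n) (cong product (sym (List.filter-all (λ d → ¬? (d ℕ.≟ 0)) d≢0))) p∣n
    where
    -- Here `b / a` = 7/5, and the growth exponent is about 0.71675.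
    open UpperBound nonzero-digits weight₁ 10000 5 7 717 1000
      (toWitness {a? = All.all? (λ d → 10000 ^ 5 ℕ.≤? weight₁ d ^ 5 * nonzero d ^ 7) nonzero-digits} _)
      (toWitness {a? = 10000 ^ 5 ℕ.≤? 10 ^ 7 * sum (map weight₁ nonzero-digits) ^ 5} _)
      (toWitness {a? = (10 ^ 7 * sum (map weight₁ nonzero-digits) ^ 5) ^ 1000 ℕ.<? 10 ^ (717 * 12) * (10000 ^ 5) ^ 1000} _)
    -- A zero digit makes the product 0, which divides no positive number; hence filtering out zeros
    -- changes nothing.
    no-zeros : ∀ {n} → 0 < n → product (digits n) ∣ n → All (λ d → ¬ d ≡ 0) (digits n)
    no-zeros {n} 0<n p∣n = All.tabulate λ where
      0∈ refl → ℕ.<-irrefl (sym (ℕ.0∣⇒≡0 (∣-trans (∈⇒∣product 0∈) p∣n))) 0<n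
    nonzero-digit : ∀ {d} → (¬ d ≡ 0) × d < 10 → d ∈ nonzero-digits
    nonzero-digit {zero}  (d≢0 , _)      = contradiction refl d≢0
    nonzero-digit {suc d} (_ , s≤s d<9) = ∈-map⁺ suc (∈-upTo⁺ d<9)

-- Lower bound

length-concatMap-const : ∀ (f : A → List B) c {xs} → All (λ x → length (f x) ≡ c) xs →
                         length (concatMap f xs) ≡ length xs * c
length-concatMap-const f c []                    = refl
length-concatMap-const f c (_∷_ {x} eq eqs) =
  trans (List.length-++ (f x)) (cong₂ _+_ eq (length-concatMap-const f c eqs))

Unique-words : ∀ {ds} → Unique ds → ∀ j → Unique (words ds j)
Unique-words ds! zero    = [] ∷ []
Unique-words ds! (suc j) = Unique.cartesianProductWith⁺ _∷_ List.∷-injective ds! (Unique-words ds! j)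

length-words : ∀ ds j → length (words ds j) ≡ length ds ^ j
length-words ds zero    = refl
length-words ds (suc j) = trans (length-cartesianProductWith _∷_ ds (words ds j))
  (cong (length ds *_) (length-words ds j))

-- Inserting copies of a new letter into words

interleavings : ℕ → List ℕ → ℕ → List (List ℕ)
interleavings z []      c       = replicate c z ∷ []
interleavings z (x ∷ w) zero    = (x ∷ w) ∷ []
interleavings z (x ∷ w) (suc c) =
  map (x ∷_) (interleavings z w (suc c)) ++ map (z ∷_) (interleavings z (x ∷ w) c)

-- Pascal's rule, splitting by whether the first letter is `x` or `z`.
length-interleavings : ∀ z w c → length (interleavings z w c) ≡ (length w + c) C c
length-interleavings z []      c       = sym (nCn≡1 c)
length-interleavings z (x ∷ w) zero    = refl
length-interleavings z (x ∷ w) (suc c) = begin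
  length (map (x ∷_) (interleavings z w (suc c)) ++ map (z ∷_) (interleavings z (x ∷ w) c))
    ≡⟨ List.length-++ (map (x ∷_) (interleavings z w (suc c))) ⟩
  length (map (x ∷_) (interleavings z w (suc c))) + length (map (z ∷_) (interleavings z (x ∷ w) c))
    ≡⟨ cong₂ _+_ (List.length-map (x ∷_) (interleavings z w (suc c)))
                  (List.length-map (z ∷_) (interleavings z (x ∷ w) c)) ⟩
  length (interleavings z w (suc c)) + length (interleavings z (x ∷ w) c)
    ≡⟨ cong₂ _+_ (length-interleavings z w (suc c)) (length-interleavings z (x ∷ w) c) ⟩
  n C suc c + suc (length w + c) C c
    ≡⟨ cong (λ i → n C suc c + i C c) (ℕ.+-suc (length w) c) ⟨
  n C suc c + n C c
    ≡⟨ ℕ.+-comm (n C suc c) (n C c) ⟩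
  n C c + n C suc c
    ≡⟨ nCk+nC[k+1]≡[n+1]C[k+1] n c ⟩
  suc n C suc c ∎
  where
  open ≡-Reasoning
  n = length w + suc c

-- A derivation records which letters of the resulting word are old and which are inserted, so that
-- length, letters and product follow by induction on it.
data Interleaving (z : ℕ) : List ℕ → ℕ → List ℕ → Set where
  []  : Interleaving z [] 0 []
  old : ∀ {x w c y} → Interleaving z w c y → Interleaving z (x ∷ w) c (x ∷ y)
  new : ∀ {w c y} → Interleaving z w c y → Interleaving z w (suc c) (z ∷ y)

interleavings-sound : ∀ z w c → All (Interleaving z w c) (interleavings z w c)
interleavings-sound z []      zero    = [] ∷ []
interleavings-sound z []      (suc c) with h ∷ [] ← interleavings-sound z [] c = new h ∷ []
interleavings-sound z (x ∷ w) zero    = untouched (x ∷ w) ∷ []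
  where
  untouched : ∀ w → Interleaving z w 0 w
  untouched []      = []
  untouched (x ∷ w) = old (untouched w)
interleavings-sound z (x ∷ w) (suc c) = All.++⁺
  (All.map⁺ (All.map old (interleavings-sound z w (suc c))))
  (All.map⁺ (All.map new (interleavings-sound z (x ∷ w) c)))

module _ {z : ℕ} where
  length-interleaving : ∀ {w c y} → Interleaving z w c y → length y ≡ length w + c
  length-interleaving []      = refl
  length-interleaving (old h) = cong suc (length-interleaving h)
  length-interleaving (new {w} {c} h) = trans (cong suc (length-interleaving h)) (sym (ℕ.+-suc (length w) c))

  all-interleaving : ∀ {P : ℕ → Set} {w c y} → P z → Interleaving z w c y → All P w → All P y
  all-interleaving pz []      []         = []
  all-interleaving pz (old h) (px ∷ pw) = px ∷ all-interleaving pz h pw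
  all-interleaving pz (new h) pw         = pz ∷ all-interleaving pz h pw

  nonzero-product-interleaving : ∀ {w c y} → Interleaving z w c y →
                                 nonzero-product y ≡ nonzero-product w * nonzero z ^ c
  nonzero-product-interleaving []      = refl
  nonzero-product-interleaving (old {x} {w} {c} {y} h) = begin
    nonzero-product (x ∷ y)                          ≡⟨ nonzero-product-∷ x y ⟩
    nonzero x * nonzero-product y                    ≡⟨ cong (nonzero x *_) (nonzero-product-interleaving h) ⟩
    nonzero x * (nonzero-product w * nonzero z ^ c)  ≡⟨ ℕ.*-assoc (nonzero x) (nonzero-product w) (nonzero z ^ c) ⟨
    nonzero x * nonzero-product w * nonzero z ^ c    ≡⟨ cong (_* nonzero z ^ c) (nonzero-product-∷ x w) ⟨
    nonzero-product (x ∷ w) * nonzero z ^ c          ∎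
    where open ≡-Reasoning
  nonzero-product-interleaving (new {w} {c} {y} h) = begin
    nonzero-product (z ∷ y)                          ≡⟨ nonzero-product-∷ z y ⟩
    nonzero z * nonzero-product y                    ≡⟨ cong (nonzero z *_) (nonzero-product-interleaving h) ⟩
    nonzero z * (nonzero-product w * nonzero z ^ c)  ≡⟨ x∙yz≈y∙xz (nonzero z) (nonzero-product w) (nonzero z ^ c) ⟩
    nonzero-product w * (nonzero z * nonzero z ^ c)  ∎
    where open ≡-Reasoning

  other? = λ x → ¬? (x ℕ.≟ z)

  -- Only inserted letters equal `z`. This left inverse keeps the interleavings of different words
  -- apart in `insert-all-family`.
  remove-interleaving : ∀ {w c y} → z ∉ w → Interleaving z w c y → filter other? y ≡ w
  remove-interleaving z∉ []      = refl
  remove-interleaving z∉ (old {x} h) = trans (List.filter-accept other? (λ x≡z → z∉ (here (sym x≡z))))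
    (cong (x ∷_) (remove-interleaving (z∉ ∘ there) h))
  remove-interleaving z∉ (new h) = trans (List.filter-reject other? (λ z≢z → z≢z refl))
    (remove-interleaving z∉ h)

-- The two halves begin with `x` and with `z`, which differ because `z ∉ x ∷ w`.
Unique-interleavings : ∀ {z} w c → z ∉ w → Unique (interleavings z w c)
Unique-interleavings []      c       z∉ = [] ∷ []
Unique-interleavings (x ∷ w) zero    z∉ = [] ∷ []
Unique-interleavings {z} (x ∷ w) (suc c) z∉ = Unique.++⁺
  (Unique.map⁺ List.∷-injectiveʳ (Unique-interleavings w (suc c) (z∉ ∘ there)))
  (Unique.map⁺ List.∷-injectiveʳ (Unique-interleavings (x ∷ w) c z∉))
  λ (y∈ , y∈′) → let _ , _ , eq = ∈-map⁻ (x ∷_) y∈ ; _ , _ , eq′ = ∈-map⁻ (z ∷_) y∈′ in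
    z∉ (here (List.∷-injectiveˡ (trans (sym eq′) eq)))

-- Common length and product make insertion repeatable: `c` copies of a new letter multiply the
-- number of words by one binomial coefficient and the product by a fixed power.
record Family (as : List ℕ) (L D : ℕ) (T : List (List ℕ)) : Set where
  field
    unique : Unique T
    members : All (λ w → length w ≡ L × All (_∈ as) w × nonzero-product w ≡ D) T

binary-words : ∀ a → Family (0 ∷ 1 ∷ []) a 1 (words (0 ∷ 1 ∷ []) a)
binary-words a = record
  { unique  = Unique-words (((λ ()) ∷ []) ∷ [] ∷ []) a
  ; members = All.tabulate (member a)
  }
  where
  member : ∀ a {w} → w ∈ words (0 ∷ 1 ∷ []) a →
           length w ≡ a × All (_∈ 0 ∷ 1 ∷ []) w × nonzero-product w ≡ 1
  member zero    (here refl) = refl , [] , refl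
  member (suc a) w∈ with ∈-cartesianProductWith⁻ _∷_ (0 ∷ 1 ∷ []) (words (0 ∷ 1 ∷ []) a) w∈
  ... | d , w , d∈ , w∈′ , refl = let len , w⊆ , prod = member a w∈′ in
    cong suc len , d∈ ∷ w⊆ ,
    trans (nonzero-product-∷ d w) (trans (cong (_* nonzero-product w) (one d∈)) (trans (ℕ.*-identityˡ _) prod))
    where
    one : ∀ {d} → d ∈ 0 ∷ 1 ∷ [] → nonzero d ≡ 1
    one (here refl)         = refl
    one (there (here refl)) = refl

insert-all : ℕ → ℕ → List (List ℕ) → List (List ℕ)
insert-all z c = concatMap (λ w → interleavings z w c)

module _ {as L D T} (z c : ℕ) (z∉as : z ∉ as) (F : Family as L D T) where
  open Family F

  private
    z∉ : ∀ {w} → All (_∈ as) w → z ∉ w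
    z∉ w⊆ z∈ = z∉as (All.lookup w⊆ z∈)

  insert-all-family : Family (z ∷ as) (L + c) (D * nonzero z ^ c) (insert-all z c T)
  insert-all-family = record
    { unique  = Unique-concatMap _ (filter (other? {z})) unique (All.map
        (λ {w} (_ , w⊆ , _) → Unique-interleavings w c (z∉ w⊆) ,
          All.map (remove-interleaving (z∉ w⊆)) (interleavings-sound z w c))
        members)
    ; members = All.concat⁺ (All.map⁺ (All.map
        (λ {w} (len , w⊆ , prod) → All.map
          (λ h → trans (length-interleaving h) (cong (_+ c) len) ,
                 all-interleaving (here refl) h (All.map there w⊆) ,
                 trans (nonzero-product-interleaving h) (cong (_* nonzero z ^ c) prod))
          (interleavings-sound z w c))
        members))
    }

  length-insert-all : length (insert-all z c T) ≡ length T * ((L + c) C c)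
  length-insert-all = length-concatMap-const _ _
    (All.map (λ {w} (len , _) → trans (length-interleavings z w c) (cong (λ l → (l + c) C c) len)) members)

-- Numbers from concatenated words

digits-append : ∀ {q w} → 0 < q → All (_< 10) w → digits (append-digits q w) ≡ digits q ++ w
digits-append {q} 0<q []                       = sym (List.++-identityʳ (digits q))
digits-append {q} {d ∷ w} 0<q (d<10 ∷ w<10) = begin
  digits (append-digits (d + q * 10) w)   ≡⟨ digits-append 0<d+10q w<10 ⟩
  digits (d + q * 10) ++ w                ≡⟨ cong (_++ w) (digits-snoc 0<q d<10) ⟩
  (digits q ++ d ∷ []) ++ w               ≡⟨ List.++-assoc (digits q) (d ∷ []) w ⟩
  digits q ++ d ∷ w                       ∎
  where
  open ≡-Reasoning
  0<d+10q : 0 < d + q * 10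
  0<d+10q = ℕ.≤-trans 0<q (ℕ.≤-trans (ℕ.m≤m*n q 10) (ℕ.m≤n+m (q * 10) d))

append-zeros : ∀ q i → append-digits q (replicate i 0) ≡ 10 ^ i * q
append-zeros q zero    = sym (ℕ.*-identityˡ q)
append-zeros q (suc i) = trans (append-zeros (q * 10) i)
  (trans (cong (10 ^ i *_) (ℕ.*-comm q 10)) (trans (sym (ℕ.*-assoc (10 ^ i) 10 q)) (cong (_* q) (ℕ.*-comm (10 ^ i) 10))))

concatenations : List (List ℕ) → ℕ → List (List ℕ)
concatenations T zero    = [] ∷ []
concatenations T (suc j) = concatMap (λ u → map (u ++_) (concatenations T j)) T

length-concatenations : ∀ T j → length (concatenations T j) ≡ length T ^ j
length-concatenations T zero    = refl
length-concatenations T (suc j) = length-concatMap-const _ (length T ^ j) (All.universal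
  (λ u → trans (List.length-map (u ++_) (concatenations T j)) (length-concatenations T j)) T)

-- Divisibility into `P` is preserved when words are joined and their values of `P` multiplied.
Block : ℕ → ℕ → List ℕ → Set
Block L P w = length w ≡ L × All (_< 10) w × nonzero-product w ∣ P

concatenations-blocks : ∀ {L P T} → All (Block L P) T → ∀ j → All (Block (j * L) (P ^ j)) (concatenations T j)
concatenations-blocks T-blocks zero    = (refl , [] , ℕ.∣-refl) ∷ []
concatenations-blocks {L} {P} {T} T-blocks (suc j) = All.concat⁺ (All.map⁺ (All.map extend T-blocks))
  where
  extend : ∀ {u} → Block L P u → All (Block (suc j * L) (P ^ suc j)) (map (u ++_) (concatenations T j))
  extend {u} (|u| , u<10 , pu∣) = All.map⁺ (All.map
    (λ {w} (|w| , w<10 , pw∣) →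
      trans (List.length-++ u) (cong₂ _+_ |u| |w|) ,
      All.++⁺ u<10 w<10 ,
      subst (_∣ P ^ suc j) (sym (nonzero-product-++ u w)) (ℕ.*-pres-∣ pu∣ pw∣))
    (concatenations-blocks T-blocks j))

take-length-++ : ∀ (u w : List ℕ) → take (length u) (u ++ w) ≡ u
take-length-++ []      w = refl
take-length-++ (x ∷ u) w = cong (x ∷_) (take-length-++ u w)

-- All words of `T` have length `L`, so `take L` recovers the first one, and left cancellation the
-- remainder.
Unique-concatenations : ∀ {L P T} → Unique T → All (Block L P) T → ∀ j → Unique (concatenations T j)
Unique-concatenations T! T-blocks zero    = [] ∷ []
Unique-concatenations {L} {T = T} T! T-blocks (suc j) = Unique-concatMap _ (take L) T!
  (All.map (λ {u} (|u| , _) →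
    Unique.map⁺ (List.++-cancelˡ u _ _) (Unique-concatenations T! T-blocks j) ,
    All.map⁺ (All.universal (λ w → subst (λ l → take l (u ++ w) ≡ u) |u| (take-length-++ u w)) _)) T-blocks)

-- A block w of type P = 10 ^ K yields the number with decimal expansion 1 w 0…0
-- (K zeros), which is divisible by 10 ^ K.
module LowerBound
  (T : List (List ℕ)) (L K e k : ℕ) .{{_ : NonZero L}}
  (T! : Unique T) (T-blocks : All (Block L (10 ^ K)) T)
  -- The factor 2 is a surplus per word; `j` words accumulate `2 ^ j`, which outgrows every fixed
  -- constant.
  (gap : 2 * 10 ^ (e * (L + K)) ≤ length T ^ k)
  where

  open ℕ.≤-Reasoning

  private
    H = L + K

  module _ (j : ℕ) where
    zeros : List ℕ
    zeros = replicate (K * j) 0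

    number : List ℕ → ℕ
    number w = append-digits 1 (w ++ zeros)

    digits-number : ∀ {w} → All (_< 10) w → digits (number w) ≡ 1 ∷ w ++ zeros
    digits-number w<10 = digits-append (s≤s z≤n) (All.++⁺ w<10 (All.replicate⁺ (K * j) (s≤s z≤n)))

    numbers : List ℕ
    numbers = map number (concatenations T j)

    blocks : All (Block (j * L) ((10 ^ K) ^ j)) (concatenations T j)
    blocks = concatenations-blocks T-blocks j

    length-numbers : length numbers ≡ length T ^ j
    length-numbers = trans (List.length-map number (concatenations T j)) (length-concatenations T j)

    nonzero-product-zeros : ∀ i → nonzero-product (replicate i 0) ≡ 1
    nonzero-product-zeros zero    = refl
    nonzero-product-zeros (suc i) = nonzero-product-zeros i

    number-spec : ∀ {n} → n ∈ numbers → 0 < n × n < 10 ^ suc (j * H) × p₁₀,₀ n ∣ n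
    number-spec n∈ with w , w∈ , refl ← ∈-map⁻ number n∈ with |w| , w<10 , pw∣ ← All.lookup blocks w∈ =
      0<n , subst (λ l → number w < 10 ^ l) len (n<10^length-digits (number w)) ,
      subst (_∣ number w) (sym product-number) (∣-trans pw∣ 10^K∣)
      where
      number-zeros : number w ≡ 10 ^ (K * j) * append-digits 1 w
      number-zeros = trans (List.foldl-++ _ 1 w zeros) (append-zeros (append-digits 1 w) (K * j))
      10^K∣ : (10 ^ K) ^ j ∣ number w
      10^K∣ = subst₂ _∣_ (sym (ℕ.^-*-assoc 10 K j)) (sym number-zeros) (m∣m*n _)
      0<append : ∀ w {q} → 0 < q → 0 < append-digits q w
      0<append []      0<q = 0<q
      0<append (d ∷ w) {q} 0<q = 0<append w (ℕ.≤-trans 0<q (ℕ.≤-trans (ℕ.m≤m*n q 10) (ℕ.m≤n+m (q * 10) d)))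
      0<n : 0 < number w
      0<n = 0<append (w ++ zeros) (s≤s z≤n)
      product-number : p₁₀,₀ (number w) ≡ nonzero-product w
      product-number = trans (cong nonzero-product (digits-number w<10))
        (trans (ℕ.*-identityˡ _)
        (trans (nonzero-product-++ w zeros)
        (trans (cong (nonzero-product w *_) (nonzero-product-zeros (K * j))) (ℕ.*-identityʳ _))))
      -- `suc` counts the leading 1, which keeps zeros at the start of `w` as genuine digits.
      len : length (digits (number w)) ≡ suc (j * H)
      len = trans (cong length (digits-number w<10)) (cong suc (trans (List.length-++ w)
        (trans (cong₂ _+_ |w| (trans (List.length-replicate (K * j)) (ℕ.*-comm K j)))
          (sym (ℕ.*-distribˡ-+ j L K)))))

    Unique-numbers : Unique numbers
    Unique-numbers = map-unique blocks (Unique-concatenations T! T-blocks j)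
      where
      number-injective : ∀ {u w} → All (_< 10) u → All (_< 10) w → number u ≡ number w → u ≡ w
      number-injective {u} {w} u<10 w<10 eq = List.++-cancelʳ zeros u w (List.∷-injectiveʳ
        (trans (sym (digits-number u<10)) (trans (cong digits eq) (digits-number w<10))))
      map-unique : ∀ {ws} → All (Block (j * L) ((10 ^ K) ^ j)) ws → Unique ws → Unique (map number ws)
      map-unique []                        []            = []
      map-unique ((_ , w<10 , _) ∷ bs) (w∉ ∷ ws!) =
        All.map⁺ (All.zipWith (λ ((_ , u<10 , _) , w≢u) eq → w≢u (number-injective w<10 u<10 eq)) (bs , w∉))
        ∷ map-unique bs ws!

  private
    -- This is the part of `(10 ^ (2 + suc j * H)) ^ e` that does not grow with `j`.
    C = 10 ^ (e * (2 + H))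

  -- `j` is chosen with `10 ^ (1 + j * H) ≤ m < 10 ^ (1 + (j + 1) *
  -- H)`, so the numbers with `j` blocks stay below `m`. The threshold for `m` forces `C ≤ j < 2 ^
  -- j`, and the surplus absorbs `C`.
  lower-bound : LowerCount p₁₀,₀ e k
  lower-bound = 10 ^ suc (C * H) , bound
    where
    bound : ∀ {m} → 10 ^ suc (C * H) ≤ m → ∃ λ ns → Unique ns ×
      (∀ {n} → n ∈ ns → n ≤ m × 0 < n × p₁₀,₀ n ∣ n) × (2 + m) ^ e < length ns ^ k
    bound {m} M≤m = numbers j , Unique-numbers j ,
      (λ n∈ → let 0<n , n< , p∣ = number-spec j n∈ in
        ℕ.<⇒≤ (ℕ.<-≤-trans n< (ℕ.≮⇒≥ (proj₁ (proj₂ scale)))) , 0<n , p∣) ,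
      (begin-strict
        (2 + m) ^ e                          ≤⟨ ℕ.^-monoˡ-≤ e 2+m≤ ⟩
        (10 ^ (2 + suc j * H)) ^ e           ≡⟨ exponents ⟩
        C * (10 ^ (e * H)) ^ j               <⟨ ℕ.*-monoˡ-< _ {{ℕ.m^n≢0 (10 ^ (e * H)) j {{ℕ.m^n≢0 10 (e * H)}}}} C<2^j ⟩
        2 ^ j * (10 ^ (e * H)) ^ j           ≡⟨ ^-distribʳ-* 2 (10 ^ (e * H)) j ⟨
        (2 * 10 ^ (e * H)) ^ j               ≤⟨ ℕ.^-monoˡ-≤ j gap ⟩
        (length T ^ k) ^ j                   ≡⟨ ^-swap (length T) k j ⟩
        (length T ^ j) ^ k                   ≡⟨ cong (_^ k) (length-numbers j) ⟨
        length (numbers j) ^ k               ∎)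
      where
      1≤H : 1 ≤ H
      1≤H = ℕ.≤-trans (>-nonZero⁻¹ L) (ℕ.m≤m+n L K)
      m<10^ : m < 10 ^ suc (m * H)
      m<10^ = begin-strict
        m                     <⟨ n<m^n (s≤s (s≤s z≤n)) m ⟩
        10 ^ m                ≤⟨ ℕ.^-monoʳ-≤ 10 (ℕ.≤-trans (ℕ.m≤m*n m H {{>-nonZero 1≤H}}) (ℕ.n≤1+n _)) ⟩
        10 ^ suc (m * H)      ∎
      10≤m : ¬ m < 10 ^ suc (0 * H)
      10≤m m<10 = ℕ.<-irrefl refl (ℕ.<-≤-trans m<10
        (ℕ.≤-trans (ℕ.^-monoʳ-≤ 10 {1} {suc (C * H)} (s≤s z≤n)) M≤m))
      scale : ∃ λ j → ¬ m < 10 ^ suc (j * H) × m < 10 ^ suc (suc j * H)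
      scale = crossing (λ j → m ℕ.<? 10 ^ suc (j * H)) 10≤m m m<10^
      j = proj₁ scale
      C≤j : C ≤ j
      C≤j = ℕ.≮⇒≥ λ j<C → ℕ.<-irrefl refl (begin-strict
        m                         <⟨ proj₂ (proj₂ scale) ⟩
        10 ^ suc (suc j * H)      ≤⟨ ℕ.^-monoʳ-≤ 10 (s≤s (ℕ.*-monoˡ-≤ H j<C)) ⟩
        10 ^ suc (C * H)          ≤⟨ M≤m ⟩
        m                         ∎)
      C<2^j : C < 2 ^ j
      C<2^j = ℕ.≤-<-trans C≤j (n<m^n (s≤s (s≤s z≤n)) j)
      2+m≤ : 2 + m ≤ 10 ^ (2 + suc j * H)
      2+m≤ = begin
        1 + suc m                          ≤⟨ ℕ.+-mono-≤ (ℕ.≤-trans (s≤s z≤n) (proj₂ (proj₂ scale))) (proj₂ (proj₂ scale)) ⟩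
        X + X                              ≡⟨ cong (X +_) (ℕ.+-identityʳ X) ⟨
        2 * X                              ≤⟨ ℕ.*-monoˡ-≤ X {2} {10} (s≤s (s≤s z≤n)) ⟩
        10 * X                             ∎
        where X = 10 ^ suc (suc j * H)
      exponents : (10 ^ (2 + suc j * H)) ^ e ≡ C * (10 ^ (e * H)) ^ j
      exponents = begin-equality
        (10 ^ (2 + (H + j * H))) ^ e       ≡⟨ ℕ.^-*-assoc 10 (2 + (H + j * H)) e ⟩
        10 ^ ((2 + (H + j * H)) * e)       ≡⟨ cong (10 ^_) (solve 3 (λ H j e → (con 2 :+ (H :+ j :* H)) :* e := e :* (con 2 :+ H) :+ e :* H :* j) refl H j e) ⟩
        10 ^ (e * (2 + H) + e * H * j)     ≡⟨ ℕ.^-distribˡ-+-* 10 (e * (2 + H)) (e * H * j) ⟩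
        C * 10 ^ (e * H * j)               ≡⟨ cong (C *_) (ℕ.^-*-assoc 10 (e * H) j) ⟨
        C * (10 ^ (e * H)) ^ j             ∎
        where open +-*-Solver

-- The words with c₅ fives, c₂ twos, c₄ fours, c₈ eights and a further letters
-- from {0, 1}.
lower-bound-by-counts : ∀ a c₅ c₂ c₄ c₈ {L K} h e k .{{_ : NonZero L}} .{{_ : NonZero k}} →
  a + c₅ + c₂ + c₄ + c₈ ≡ L →
  1 * 5 ^ c₅ * 2 ^ c₂ * 4 ^ c₄ * 8 ^ c₈ ≡ 10 ^ K →
  h * k ≡ e * (L + K) →
  2 * 10 ^ h ≤ 2 ^ a * ((a + c₅) C c₅) * ((a + c₅ + c₂) C c₂) *
               ((a + c₅ + c₂ + c₄) C c₄) * ((a + c₅ + c₂ + c₄ + c₈) C c₈) →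
  LowerCount p₁₀,₀ e k
lower-bound-by-counts a c₅ c₂ c₄ c₈ {L} {K} h e k refl product≡ exponent≡ large =
  LowerBound.lower-bound T₈ L K e k (unique F₈) blocks gap
  where
  open Family
  open ℕ.≤-Reasoning
  T₀ = words (0 ∷ 1 ∷ []) a
  T₅ = insert-all 5 c₅ T₀
  T₂ = insert-all 2 c₂ T₅
  T₄ = insert-all 4 c₄ T₂
  T₈ = insert-all 8 c₈ T₄
  F₀ = binary-words a
  5∉ : 5 ∉ 0 ∷ 1 ∷ []
  5∉ = λ where (there (there ()))
  2∉ : 2 ∉ 5 ∷ 0 ∷ 1 ∷ []
  2∉ = λ where (there (there (there ())))
  4∉ : 4 ∉ 2 ∷ 5 ∷ 0 ∷ 1 ∷ []
  4∉ = λ where (there (there (there (there ()))))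
  8∉ : 8 ∉ 4 ∷ 2 ∷ 5 ∷ 0 ∷ 1 ∷ []
  8∉ = λ where (there (there (there (there (there ())))))
  F₅ = insert-all-family 5 c₅ 5∉ F₀
  F₂ = insert-all-family 2 c₂ 2∉ F₅
  F₄ = insert-all-family 4 c₄ 4∉ F₂
  F₈ = insert-all-family 8 c₈ 8∉ F₄
  length-T₈ : length T₈ ≡ 2 ^ a * ((a + c₅) C c₅) * ((a + c₅ + c₂) C c₂) *
                          ((a + c₅ + c₂ + c₄) C c₄) * ((a + c₅ + c₂ + c₄ + c₈) C c₈)
  length-T₈ = step 8 8∉ F₄ (step 4 4∉ F₂ (step 2 2∉ F₅ (step 5 5∉ F₀ (length-words (0 ∷ 1 ∷ []) a))))
    where
    step : ∀ {as L D T x} z {c} → z ∉ as → Family as L D T → length T ≡ x →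
           length (insert-all z c T) ≡ x * ((L + c) C c)
    step z {c} z∉ F eq = trans (length-insert-all z c z∉ F) (cong (_* _) eq)
  letters-<10 : All (_< 10) (8 ∷ 4 ∷ 2 ∷ 5 ∷ 0 ∷ 1 ∷ [])
  letters-<10 = toWitness {a? = All.all? (ℕ._<? 10) _} _
  blocks : All (Block L (10 ^ K)) T₈
  blocks = All.map (λ (len , w⊆ , prod) →
    len , All.map (All.lookup letters-<10) w⊆ , ℕ.∣-reflexive (trans prod product≡)) (members F₈)
  gap : 2 * 10 ^ (e * (L + K)) ≤ length T₈ ^ k
  -- `h` is the `k`-th part of `e * (L + K)`, so `large` concerns `length T₈` itself and is raised
  -- to the power `k` only here; of `2 ^ k` a single factor 2 is kept.
  gap = begin
    2 * 10 ^ (e * (L + K))       ≡⟨ cong₂ (λ x i → x * 10 ^ i) (ℕ.^-identityʳ 2) exponent≡ ⟨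
    2 ^ 1 * 10 ^ (h * k)         ≤⟨ ℕ.*-monoˡ-≤ (10 ^ (h * k)) (ℕ.^-monoʳ-≤ 2 (>-nonZero⁻¹ k)) ⟩
    2 ^ k * 10 ^ (h * k)         ≡⟨ cong (2 ^ k *_) (ℕ.^-*-assoc 10 h k) ⟨
    2 ^ k * (10 ^ h) ^ k         ≡⟨ ^-distribʳ-* 2 (10 ^ h) k ⟨
    (2 * 10 ^ h) ^ k             ≤⟨ ℕ.^-monoˡ-≤ k large ⟩
    _                            ≡⟨ cong (_^ k) length-T₈ ⟨
    length T₈ ^ k                ∎

-- The proportions of the letters approximately maximise the entropy of the words
-- per digit of the number, given c₅ = c₂ + 2 c₄ + 3 c₈; the optimum allows the
-- exponent 0.52653…, so the length 11710 has to be large to reach 0.526.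
abstract
  𝒩₁₀,₀-lower : LowerCount p₁₀,₀ 526 1000
  -- Here `L + K` is 14500 and `526 * 14500 = 7627 * 1000`, which makes `h` an integer.
  𝒩₁₀,₀-lower = lower-bound-by-counts 6967 2790 1294 481 178 {11710} {2790} 7627 526 1000 refl
    (toWitness {a? = 1 * 5 ^ 2790 * 2 ^ 1294 * 4 ^ 481 * 8 ^ 178 ℕ.≟ 10 ^ 2790} _) refl
    (toWitness {a? = 2 * 10 ^ 7627 ℕ.≤? 2 ^ 6967 * (9757 C 2790) * (11051 C 1294) * (11532 C 481) * (11710 C 178)} _)

-- Comparison with real powers

fromℕℚ-+ : ∀ m n → fromℕℚ (m + n) ≡ fromℕℚ m ℚ.+ fromℕℚ n
fromℕℚ-+ zero    n = sym (ℚ.+-identityˡ (fromℕℚ n))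
fromℕℚ-+ (suc m) n = begin
  fromℕℚ (suc (m + n))                  ≡⟨ fromℕℚ-suc (m + n) ⟩
  fromℕℚ (m + n) ℚ.+ 1ℚ                 ≡⟨ cong (ℚ._+ 1ℚ) (fromℕℚ-+ m n) ⟩
  fromℕℚ m ℚ.+ fromℕℚ n ℚ.+ 1ℚ          ≡⟨ ℚ.+-assoc (fromℕℚ m) (fromℕℚ n) 1ℚ ⟩
  fromℕℚ m ℚ.+ (fromℕℚ n ℚ.+ 1ℚ)        ≡⟨ cong (fromℕℚ m ℚ.+_) (ℚ.+-comm (fromℕℚ n) 1ℚ) ⟩
  fromℕℚ m ℚ.+ (1ℚ ℚ.+ fromℕℚ n)        ≡⟨ ℚ.+-assoc (fromℕℚ m) 1ℚ (fromℕℚ n) ⟨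
  fromℕℚ m ℚ.+ 1ℚ ℚ.+ fromℕℚ n          ≡⟨ cong (ℚ._+ fromℕℚ n) (fromℕℚ-suc m) ⟨
  fromℕℚ (suc m) ℚ.+ fromℕℚ n           ∎
  where open ≡-Reasoning

fromℕℚ-* : ∀ m n → fromℕℚ (m * n) ≡ fromℕℚ m ℚ.* fromℕℚ n
fromℕℚ-* zero    n = sym (ℚ.*-zeroˡ (fromℕℚ n))
fromℕℚ-* (suc m) n = begin
  fromℕℚ (n + m * n)                               ≡⟨ fromℕℚ-+ n (m * n) ⟩
  fromℕℚ n ℚ.+ fromℕℚ (m * n)                      ≡⟨ cong (fromℕℚ n ℚ.+_) (fromℕℚ-* m n) ⟩
  fromℕℚ n ℚ.+ fromℕℚ m ℚ.* fromℕℚ n               ≡⟨ ℚ.+-comm (fromℕℚ n) (fromℕℚ m ℚ.* fromℕℚ n) ⟩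
  fromℕℚ m ℚ.* fromℕℚ n ℚ.+ fromℕℚ n               ≡⟨ cong (fromℕℚ m ℚ.* fromℕℚ n ℚ.+_) (ℚ.*-identityˡ (fromℕℚ n)) ⟨
  fromℕℚ m ℚ.* fromℕℚ n ℚ.+ 1ℚ ℚ.* fromℕℚ n        ≡⟨ ℚ.*-distribʳ-+ (fromℕℚ n) (fromℕℚ m) 1ℚ ⟨
  (fromℕℚ m ℚ.+ 1ℚ) ℚ.* fromℕℚ n                   ≡⟨ cong (ℚ._* fromℕℚ n) (fromℕℚ-suc m) ⟨
  fromℕℚ (suc m) ℚ.* fromℕℚ n                      ∎
  where open ≡-Reasoning

fromℕℚ-^ : ∀ m n → fromℕℚ (m ^ n) ≡ fromℕℚ m ^ℚ n
fromℕℚ-^ m zero    = refl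
fromℕℚ-^ m (suc n) = trans (fromℕℚ-* m (m ^ n)) (cong (fromℕℚ m ℚ.*_) (fromℕℚ-^ m n))

fromℕℚ-mono-< : ∀ {m n} → m < n → fromℕℚ m ℚ.< fromℕℚ n
fromℕℚ-mono-< {m} {n} m<n = begin-strict
  fromℕℚ m              ≡⟨ ℚ.+-identityʳ (fromℕℚ m) ⟨
  fromℕℚ m ℚ.+ 0ℚ       <⟨ ℚ.+-monoʳ-< (fromℕℚ m) 0<1 ⟩
  fromℕℚ m ℚ.+ 1ℚ       ≡⟨ fromℕℚ-suc m ⟨
  fromℕℚ (suc m)        ≤⟨ fromℕℚ-mono-≤ m<n ⟩
  fromℕℚ n              ∎
  where open ℚ.≤-Reasoning

fromℕℚ-^-mono-< : ∀ {m n d e} → m ^ d < n ^ e → fromℕℚ m ^ℚ d ℚ.< fromℕℚ n ^ℚ e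
fromℕℚ-^-mono-< {m} {n} {d} {e} h = subst₂ ℚ._<_ (fromℕℚ-^ m d) (fromℕℚ-^ n e) (fromℕℚ-mono-< h)

0≤fromℕℚ : ∀ n → 0ℚ ℚ.≤ fromℕℚ n
0≤fromℕℚ n = fromℕℚ-mono-≤ {0} {n} z≤n

module _ (x : ℝ) where
  open ℝ x

  -- The floor of x is not computable, but it is up to an error of one.
  abstract
    approximate-floor : fromℕ 0 <ℝ x → ∃ λ m → L (fromℕℚ m) × U (fromℕℚ (2 + m))
    approximate-floor (q , 0<q , Lq) =
      let u , Uu = U-inhabited ; N , u<N = archimedean u in
      descend N (U-upper (ℚ.<-trans u<N (fromℕℚ-mono-< (ℕ.n<1+n N))) Uu)
      where
      descend : ∀ N → U (fromℕℚ (suc N)) → ∃ λ m → L (fromℕℚ m) × U (fromℕℚ (2 + m))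
      descend zero    U1 = 0 , L-lower 0<q Lq , U-upper (fromℕℚ-mono-< (ℕ.n<1+n 1)) U1
      -- Locating `x` between `N` and `N + 1` either yields `N < x`, with `x < N + 2` known, or
      -- improves the upper bound to `N + 1`.
      descend (suc N) U2 with located (fromℕℚ-mono-< (ℕ.n<1+n N))
      ... | inj₁ LN = N , LN , U2
      ... | inj₂ U1 = descend N U1

  -- Openness of the upper cut supplies a rational strictly between `x` and `N`, as `<ℝ` demands.
  ≤ℝ⇒< : ∀ n N → U (fromℕℚ N) → fromℕ n ≤ℝ x → n < N
  ≤ℝ⇒< n N UN n≤x = ℕ.≰⇒> λ N≤n → let q , q<N , Uq = U-open UN in
    n≤x (q , Uq , ℚ.<-≤-trans q<N (fromℕℚ-mono-≤ N≤n))

  ≤⇒≤ℝ : ∀ m n → L (fromℕℚ m) → n ≤ m → fromℕ n ≤ℝ x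
  ≤⇒≤ℝ m n Lm n≤m (q , Uq , q<n) = ℚ.<-asym (L<U Lm Uq) (ℚ.<-≤-trans q<n (fromℕℚ-mono-≤ n≤m))

  module _ (x>0 : fromℕ 0 <ℝ x) (e d : ℕ) .{{_ : NonZero e}} .{{_ : NonZero d}} where

    -- Density of `d`-th powers gives `t` with `k ^ d < t ^ d < m ^ e`; this `t` separates `k` from
    -- the power, with `m` as the witness in the lower cut.
    <-power : ∀ m k → 0 < m → L (fromℕℚ m) → k ^ d < m ^ e → fromℕ k <ℝ power x x>0 e d
    <-power m k 0<m Lm h =
      let t , 0<t , k<t , t<m = ^-dense d (^-nonNeg d (0≤fromℕℚ k)) (fromℕℚ-^-mono-< {k} {m} {d} {e} h) in
      t , ^-cancel-< d (ℚ.<⇒≤ 0<t) k<t , inj₂ (fromℕℚ m , fromℕℚ-mono-< 0<m , Lm , t<m)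

    power-< : ∀ m k → U (fromℕℚ m) → m ^ e < k ^ d → power x x>0 e d <ℝ fromℕ k
    power-< m k Um h =
      let t , 0<t , m<t , t<k = ^-dense d (^-nonNeg e (0≤fromℕℚ m)) (fromℕℚ-^-mono-< {m} {k} {e} {d} h) in
      t , (0<t , fromℕℚ m , Um , m<t) , ^-cancel-< d (0≤fromℕℚ k) t<k

-- A common form to which both `𝒩₁₀` and `𝒩₁₀,₀` unfold.
Set≤ : (ℕ → ℕ) → ℝ → ℕ → Set
Set≤ p x n = 0 < n × fromℕ n ≤ℝ x × p n ∣ n

module _ {p : ℕ → ℕ} {e d : ℕ} .{{_ : NonZero e}} .{{_ : NonZero d}} where

  count-<-power : UpperCount p e d → ∃ λ M → (x : ℝ) (x>0 : fromℕ 0 <ℝ x) → fromℕ M ≤ℝ x →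
                  (k : ℕ) → # Set≤ p x ≡ k → fromℕ k <ℝ power x x>0 e d
  -- `M + 3 ≤ x < m + 2` gives `M < m`, hence also the positivity of `m`.
  count-<-power (M , bound) = 3 + M , λ where
    x x>0 M≤x _ (ns , (ns! , ∈ns⇔) , refl) →
      let m , Lm , U2+m = approximate-floor x x>0
          M<m = ℕ.≤-pred (ℕ.≤-pred (ℕ.<⇒≤ (≤ℝ⇒< x (3 + M) (2 + m) U2+m M≤x)))
      in <-power x x>0 e d m (length ns) (ℕ.≤-trans (s≤s z≤n) M<m) Lm
           (bound (ℕ.<⇒≤ M<m) ns! λ {n} n∈ →
             let 0<n , n≤x , p∣n = Equivalence.to (∈ns⇔ n) n∈ in ℕ.≤-pred (≤ℝ⇒< x n (2 + m) U2+m n≤x) , 0<n , p∣n)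

  -- Integers up to `m` lie below `x`, so the constructed list embeds in the enumeration, while
  -- `2 + m` bounds `x` from above.
  power-<-count : LowerCount p e d → ∃ λ M → (x : ℝ) (x>0 : fromℕ 0 <ℝ x) → fromℕ M ≤ℝ x →
                  (k : ℕ) → # Set≤ p x ≡ k → power x x>0 e d <ℝ fromℕ k
  power-<-count (M , bound) = 2 + M , λ where
    x x>0 M≤x _ (ns , (_ , ∈ns⇔) , refl) →
      let m , Lm , U2+m = approximate-floor x x>0
          us , us! , us-spec , large = bound (ℕ.≤-pred (ℕ.≤-pred (ℕ.<⇒≤ (≤ℝ⇒< x (2 + M) (2 + m) U2+m M≤x))))
          us⊆ns = λ {n} (n∈ : n ∈ us) → let n≤m , 0<n , p∣n = us-spec n∈ in
                    Equivalence.from (∈ns⇔ n) (0<n , ≤⇒≤ℝ x m n Lm n≤m , p∣n)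
      in power-< x x>0 e d (2 + m) (length ns) U2+m (ℕ.<-≤-trans large (ℕ.^-monoˡ-≤ d (Unique-⊆⇒length≤ us! us⊆ns)))

fromℕ-≤ℝ : ∀ x m n → m ≤ n → fromℕ n ≤ℝ x → fromℕ m ≤ℝ x
fromℕ-≤ℝ x m n m≤n n≤x (q , Uq , q<m) = n≤x (q , Uq , ℚ.<-≤-trans q<m (fromℕℚ-mono-≤ m≤n))

theorem1p2 : ∃[ x₀ ] ((x : ℝ) (x>0 : fromℕ 0 <ℝ x) → x₀ ≤ℝ x →
    ((k : ℕ) → # 𝒩₁₀ x ≡ k → fromℕ k <ℝ power x x>0 717 1000) ×
    ((k : ℕ) → # 𝒩₁₀,₀ x ≡ k →
    power x x>0 526 1000 <ℝ fromℕ k × fromℕ k <ℝ power x x>0 787 1000))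
theorem1p2 =
  let M₁ , bound₁ = count-<-power {p₁₀} {717} {1000} 𝒩₁₀-upper
      M₀ , bound₀ = count-<-power {p₁₀,₀} {787} {1000} 𝒩₁₀,₀-upper
      N₀ , bound  = power-<-count {p₁₀,₀} {526} {1000} 𝒩₁₀,₀-lower
      M = M₁ + (M₀ + N₀)
  in fromℕ M , λ x x>0 M≤x →
    bound₁ x x>0 (fromℕ-≤ℝ x M₁ M (ℕ.m≤m+n M₁ (M₀ + N₀)) M≤x) ,
    λ k #≡k →
      bound x x>0 (fromℕ-≤ℝ x N₀ M (ℕ.≤-trans (ℕ.m≤n+m N₀ M₀) (ℕ.m≤n+m (M₀ + N₀) M₁)) M≤x) k #≡k ,
      bound₀ x x>0 (fromℕ-≤ℝ x M₀ M (ℕ.≤-trans (ℕ.m≤m+n M₀ N₀) (ℕ.m≤n+m (M₀ + N₀) M₁)) M≤x) k #≡k
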